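{- Let $\ell,r\ge1$ be integers, let $p$ be a divisor of $r$ that does not divide $\ell$, and for every $q\mid p$ let $\Delta_q=\gcd(\ell,q)$. For the canonical negative-positive double Boolean automata circuit $D_{\ell,r}$ (negative left-circuit of size $\ell$, positive right-circuit of size $r$), the number of configurations of period $p$ is $$C_{p,\Delta_p}=L\!\left(\frac{p}{\Delta_p}\right)^{\Delta_p}.$$ Consequently, the number of attractors of period $p$ is $$\mathtt{A}_p^{\pm}(\ell,r)=\frac1p\sum_{q\mid p}\mu\!\left(\frac pq\right) L\!\left(\frac{q}{\Delta_q}\right)^{\Delta_q}.$$
   Context: The canonical negative-positive double Boolean automata circuit $D_{\ell,r}$ has $n=\ell+r-1$ nodes $0,\ldots,n-1$. For a configuration $x=(x_0,\ldots,x_{n-1})\in\{0,1\}^n$ write $x^L=(x_0,\ldots,x_{\ell-1})$ (states of the left-circuit) and $x^R=(x_0,x_\ell,\ldots,x_{n-1})$ (states of the right-circuit, $r$ entries). All nodes are updated in parallel by $F:\{0,1\}^n\to\{0,1\}^n$: $F(x)_i=x_{i-1}$ for $i\notin\{0,\ell\}$; $F(x)_\ell=x_0$ (if $r\ge2$); and $F(x)_0=\neg a\vee b$, where $a=x_{\ell-1}$ is the last entry of $x^L$ and $b$ is the last entry of $x^R$ (so $b=x_{n-1}$ when $r\ge 2$). A configuration $x$ has period $p$ if $F^{p}(x)=x$ ($p$ need not be minimal); it has exact period $p$ if moreover it has no period $d<p$, $d\geq 1$. An attractor of period $p$ is the orbit under $F$ of a configuration of exact period $p$. $\mu$ is the Möbius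 function. $L$ is the Lucas sequence: $L(1)=1$, $L(2)=3$, $L(m)=L(m-1)+L(m-2)$ for $m\ge3$; equivalently $L(m)=\phi^m+(-1/\phi)^m$ with $\phi=\frac{1+\sqrt5}{2}$. -}

module Defs where

open import Algebra.Properties.CommutativeMonoid.Sum using (sum)
open import Data.Bool.Base using (Bool; not; _∨_; if_then_else_)
open import Data.Fin.Base using (Fin; zero; suc; toℕ; inject₁)
open import Data.Integer.Base as ℤ using (ℤ; 0ℤ; -1ℤ)
open import Data.Integer.Properties using (+-0-commutativeMonoid)
open import Data.List.Base using (length)
open import Data.List.Relation.Unary.Unique.DecPropositional using (unique?)
open import Data.Nat.Base using (ℕ; zero; suc; pred; _+_; _<_; _^_; NonZero; ≢-nonZero; ≢-nonZero⁻¹)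
open import Data.Nat.DivMod using (_/_)
open import Data.Nat.Divisibility using (_∣?_)
open import Data.Nat.GCD using (gcd; gcd[m,n]≢0)
open import Data.Nat.GeneralisedArithmetic using (iterate)
open import Data.Nat.Primality.Factorisation using (factors; factorise)
open import Data.Nat.Properties using (_≟_)
open import Data.Product.Base using (Σ; ∃-syntax; _×_; proj₁)
open import Data.Sum.Base using (inj₂)
open import Data.Vec.Base using (Vec; _∷_; head; last; take; drop; lookup; tabulate)
open import Function.Base using (_∘_)
open import Function.Bundles using (Inverse)
open import Level using (Level; 0ℓ; _⊔_)
open import Relation.Binary.Bundles using (Setoid)
import Relation.Binary.Construct.On as On
open import Relation.Binary.PropositionalEquality using (_≡_; setoid)
open import Relation.Nullary.Decidable using (does)
open import Relation.Nullary.Negation using (¬_)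
open import Relation.Unary using (Pred)
open import Relation.Unary.Relation.Binary.Equality using (≐-setoid)

-- For r ≥ 1 the number of nodes ℓ + pred r is ℓ + r − 1.
Config : ℕ → ℕ → Set
Config ℓ r = Vec Bool (ℓ + pred r)

xᴸ : ∀ ℓ r → Config ℓ r → Vec Bool ℓ
xᴸ ℓ r = take ℓ

xᴿ : ∀ ℓ r .{{_ : NonZero ℓ}} .{{_ : NonZero r}} → Config ℓ r → Vec Bool r
xᴿ ℓ@(suc _) (suc _) x = head x ∷ drop ℓ x

-- In the last clause the node being updated is 1 + toℕ i, and inject₁ i is
-- its predecessor in the numbering of the nodes.
F : ∀ ℓ r .{{_ : NonZero ℓ}} .{{_ : NonZero r}} → Config ℓ r → Config ℓ r
F ℓ@(suc l) r@(suc s) x = tabulate update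
  where
  update : Fin (ℓ + s) → Bool
  update zero    = not (last (xᴸ ℓ r x)) ∨ last (xᴿ ℓ r x)
  update (suc i) = if does (suc (toℕ i) ≟ ℓ) then head x else lookup x (inject₁ i)

module _ (ℓ r : ℕ) .{{_ : NonZero ℓ}} .{{_ : NonZero r}} where

  HasPeriod : ℕ → Pred (Config ℓ r) 0ℓ
  HasPeriod p x = iterate (F ℓ r) x p ≡ x

  HasExactPeriod : ℕ → Pred (Config ℓ r) 0ℓ
  HasExactPeriod p x = HasPeriod p x × (∀ d → 0 < d → d < p → ¬ HasPeriod d x)

  Orbit : Config ℓ r → Pred (Config ℓ r) 0ℓ
  Orbit x y = ∃[ t ] iterate (F ℓ r) x t ≡ y

  ConfigsOfPeriod : ℕ → Setoid 0ℓ 0ℓ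
  ConfigsOfPeriod p = On.setoid {B = Σ (Config ℓ r) (HasPeriod p)} (setoid (Config ℓ r)) proj₁

  -- The set of orbits of configurations of exact period p: an orbit is
  -- presented by one of its configurations, and two presentations are
  -- identified when their orbits are equal as subsets of Config ℓ r.
  AttractorsOfPeriod : ℕ → Setoid 0ℓ 0ℓ
  AttractorsOfPeriod p =
    On.setoid {B = Σ (Config ℓ r) (HasExactPeriod p)} (≐-setoid (Config ℓ r) 0ℓ) (Orbit ∘ proj₁)

HasCardinality : ∀ {a b : Level} → Setoid a b → ℕ → Set (a ⊔ b)
HasCardinality S k = Inverse S (setoid (Fin k))

-- L(0) = 2 is the value forced by L(2) = L(1) + L(0).
L : ℕ → ℕ
L 0             = 2
L 1             = 1
L (suc (suc m)) = L (suc m) + L m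

Δ : ℕ → ℕ → ℕ
Δ ℓ q = gcd ℓ q

Δ-nonZero : ∀ ℓ q .{{_ : NonZero q}} → NonZero (Δ ℓ q)
Δ-nonZero ℓ q@(suc _) = ≢-nonZero (gcd[m,n]≢0 ℓ q (inj₂ (≢-nonZero⁻¹ q)))

C : (q d : ℕ) .{{_ : NonZero d}} → ℕ
C q d = L (q / d) ^ d

CΔ : (ℓ q : ℕ) .{{_ : NonZero q}} → ℕ
CΔ ℓ q = C q (Δ ℓ q) {{Δ-nonZero ℓ q}}

-- The Möbius function; μ 0 is a junk value.
μ : ℕ → ℤ
μ zero      = 0ℤ
μ n@(suc _) = if does (unique? _≟_ ps) then -1ℤ ℤ.^ length ps else 0ℤ
  where ps = factors (factorise n)

-- For p ≥ 1 the divisors of p are the numbers 1 + toℕ i, i : Fin p, dividing p.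
sumOverDivisors : (p : ℕ) → ((q : ℕ) .{{_ : NonZero q}} → ℤ) → ℤ
sumOverDivisors p f =
  sum +-0-commutativeMonoid {p} λ i →
    if does (suc (toℕ i) ∣? p) then f (suc (toℕ i)) else 0ℤ

{-# OPTIONS --safe #-}

-- Let s t be the state of node 0 at time t. A configuration is determined by
-- its signal s, and when q ∣ r the configurations of period q correspond to the
-- q-periodic signals with s t = ¬ s (t − ℓ) ∨ s (t − r) = ¬ s (t − ℓ) ∨ s t,
-- that is, with s t ∨ s (t + ℓ) for all t. The step +ℓ splits ℤ/q into
-- Δ = gcd(ℓ, q) cycles of length q/Δ, and on a cycle of length m these are the
-- closed walks of length m in the graph on {0, 1} with every edge except 00,
-- of which there are trace (1 1; 1 0)^m = L(m).
--
-- For the attractors, ∑_{q ∣ p} μ(p/q) [x has period q] is, for x of exact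
-- period d ∣ p, the sum of μ over the divisors of p/d, hence [d = p]. Summing
-- over x counts the configurations of exact period p, p for each attractor.
module Submission where

open import Defs
open import Data.Bool.Base using (Bool; true; false; not; _∧_; _∨_; if_then_else_)
import Data.Bool.Properties as Bool
open import Data.Fin.Base using (Fin; zero; suc; toℕ; fromℕ; fromℕ<; inject₁; _↑ˡ_; _↑ʳ_; combine; remQuot; finToFun; funToFin)
open import Data.Fin.Induction using (<-weakInduction)
open import Data.Fin.Properties using (+↔⊎; toℕ-injective; toℕ-fromℕ; toℕ-fromℕ<; toℕ-inject₁; toℕ-↑ˡ; toℕ-↑ʳ; toℕ<n; combine-remQuot; remQuot-combine; finToFun-funToFin; funToFin-finToFin)
import Data.Integer.Properties as ℤ
open import Data.Nat.Base hiding (_*_; _/_)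
open import Data.Nat.DivMod hiding (_/_)
open import Data.Nat.Divisibility
open import Data.Nat.GeneralisedArithmetic using (iterate)
open import Data.Nat.Properties
open import Data.Nat.Tactic.RingSolver using (solve-∀)
open import Data.Product.Base using (Σ; ∃-syntax; _×_; _,_; proj₁; proj₂; uncurry)
open import Data.Sum.Base using (_⊎_; inj₁; inj₂)
open import Data.Vec.Properties using (≡-dec)
open import Function.Base using (_∘_; id; it)
open import Function.Bundles using (Inverse; _↔_; mk↔ₛ′; mk⇔)
import Function.Construct.Composition as Composition
open import Level using (Level; 0ℓ)
open import Relation.Binary.Bundles using (Setoid; DecSetoid)
import Relation.Binary.Construct.On as On
open import Relation.Binary.PropositionalEquality
open import Relation.Nullary.Decidable using (Dec; yes; no; does; dec-true; dec-false; does-⇔; map′; _×-dec_; _→-dec_; ¬?)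
open import Relation.Nullary.Negation using (¬_; contradiction)
open import Relation.Unary using (Pred; Decidable; _≐_)

-- The formulas above subtract delays, whereas signals are indexed by ℕ. Since everything is
-- periodic, time is moved forward instead: -1 becomes p - 1, and a congruence becomes an equation
-- between two numbers to which multiples of the modulus have been added, which the ring solver can
-- check. The delay r disappears because advancing a configuration of period q by r, a multiple of
-- q, changes nothing. The exponent Δ comes from independence: the constraint links t only with t +
-- ℓ, so each of the Δ cycles carries its own closed walk. To read a position of ℤ/q as a cycle
-- together with a place on it, an inverse of ℓ/Δ modulo q/Δ is taken from Bézout. That ∑ μ over the
-- divisors of n > 1 vanishes is shown by removing one prime p from n and playing e off against p e.

module CyclicWords where

  open import Data.Nat.Base using (_*_; _/_)
  open import Axiom.UniquenessOfIdentityProofs.WithK using (uip)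
  open import Data.Nat.GCD using (gcd; gcd[m,n]∣m; gcd[m,n]∣n; gcd-GCD; module Bézout)
  open import Data.Sum.Function.Propositional using (_⊎-↔_)
  import Data.Vec.Functional.Relation.Binary.Pointwise.Properties as Pointwise
  open import Function.Properties.Inverse using (↔-sym; ↔-trans)

  -- Walks in the graph without the edge 00, and Lucas numbers

  data Walk : Bool → Bool → ℕ → Set where
    []  : ∀ {a} → Walk a a 0
    _∷_ : ∀ {a b c n} → a ∨ b ≡ true → Walk b c n → Walk a c (suc n)

  visit : ∀ {a b n} → Walk a b n → ℕ → Bool
  visit {a} w       zero    = a
  -- A default past the end; positions beyond the length are never read off a walk later.
  visit {a} []      (suc i) = a
  visit     (_ ∷ w) (suc i) = visit w i

  visit-end : ∀ {a b n} (w : Walk a b n) → visit w n ≡ b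
  visit-end []      = refl
  visit-end (_ ∷ w) = visit-end w

  visit-edge : ∀ {a b n} (w : Walk a b n) {i} → i < n → visit w i ∨ visit w (suc i) ≡ true
  visit-edge (e ∷ w) {zero}  _         = e
  visit-edge (_ ∷ w) {suc i} (s≤s i<n) = visit-edge w i<n

  visit-injective : ∀ {a b n} (w w′ : Walk a b n) →
                    (∀ {i} → i ≤ n → visit w i ≡ visit w′ i) → w ≡ w′
  visit-injective []      []        _    = refl
  -- Position 1 identifies the second vertices. The edge proofs then agree because they are
  -- equalities in `Bool`.
  visit-injective (e ∷ w) (e′ ∷ w′) same with refl ← same (s≤s z≤n) =
    cong₂ _∷_ (uip e e′) (visit-injective w w′ (λ i≤n → same (s≤s i≤n)))

  trace : (u : ℕ → Bool) → (∀ i → u i ∨ u (suc i) ≡ true) → ∀ n → Walk (u 0) (u n) n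
  trace u edge zero    = []
  trace u edge (suc n) = edge 0 ∷ trace (u ∘ suc) (edge ∘ suc) n

  visit-trace : ∀ u edge {n i} → i ≤ n → visit (trace u edge n) i ≡ u i
  visit-trace u edge {i = zero}  _         = refl
  visit-trace u edge {i = suc i} (s≤s i≤n) = visit-trace (u ∘ suc) (edge ∘ suc) i≤n

  visit-subst : ∀ {a b c n} (eq : b ≡ c) (w : Walk a b n) i →
                visit (subst (λ b → Walk a b n) eq w) i ≡ visit w i
  visit-subst refl w i = refl

  ClosedWalk : ℕ → Set
  ClosedWalk n = Σ Bool λ a → Walk a a n

  closedWalk-ext : ∀ {n} (v w : ClosedWalk n) →
                   (∀ {i} → i ≤ n → visit (proj₂ v) i ≡ visit (proj₂ w) i) → v ≡ w
  closedWalk-ext (a , v) (_ , w) same with refl ← same z≤n = cong (a ,_) (visit-injective v w same)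

  -- The entries of the `n`-th power of the adjacency matrix M = (1 1; 1 0), by recursion on the
  -- first step of the walk.
  walks : Bool → Bool → ℕ → ℕ
  walks true  b     (suc n) = walks true b n + walks false b n
  walks false b     (suc n) = walks true b n
  walks true  true  zero    = 1
  walks false false zero    = 1
  walks true  false zero    = 0
  walks false true  zero    = 0

  Walk↔Fin : ∀ a b n → Walk a b n ↔ Fin (walks a b n)
  Walk↔Fin true  true  zero = mk↔ₛ′ (λ _ → zero) (λ _ → []) (λ { zero → refl }) (λ { [] → refl })
  Walk↔Fin false false zero = mk↔ₛ′ (λ _ → zero) (λ _ → []) (λ { zero → refl }) (λ { [] → refl })
  Walk↔Fin true  false zero = mk↔ₛ′ (λ ()) (λ ()) (λ ()) (λ ())
  Walk↔Fin false true  zero = mk↔ₛ′ (λ ()) (λ ()) (λ ()) (λ ())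
  Walk↔Fin true  b (suc n) =
    ↔-trans step (↔-trans (Walk↔Fin true b n ⊎-↔ Walk↔Fin false b n) (↔-sym +↔⊎))
    where
    step : Walk true b (suc n) ↔ (Walk true b n ⊎ Walk false b n)
    step = mk↔ₛ′
      (λ { (_∷_ {b = true} _ w) → inj₁ w ; (_∷_ {b = false} _ w) → inj₂ w })
      (λ { (inj₁ w) → refl ∷ w ; (inj₂ w) → refl ∷ w })
      (λ { (inj₁ w) → refl ; (inj₂ w) → refl })
      (λ { (_∷_ {b = true} refl w) → refl ; (_∷_ {b = false} refl w) → refl })
  Walk↔Fin false b (suc n) = ↔-trans step (Walk↔Fin true b n)
    where
    step : Walk false b (suc n) ↔ Walk true b n
    step = mk↔ₛ′
      (λ { (_∷_ {b = true} refl w) → w })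
      (λ w → refl ∷ w)
      (λ w → refl)
      (λ { (_∷_ {b = true} refl w) → refl })

  -- The trace of M² = M + I multiplied by a power of M: unfolding the first steps regroups the
  -- trace at n + 2 into those at n + 1 and n. The value `L 0` = 2 is the trace of the identity
  -- matrix.
  closedWalks≡L : ∀ n → walks true true n + walks false false n ≡ L n
  closedWalks≡L zero = refl
  closedWalks≡L (suc zero) = refl
  closedWalks≡L (suc (suc n)) = begin
    walks true true (suc n) + walks true true n + (walks true false n + walks false false n)
      ≡⟨ regroup (walks true true (suc n)) _ _ _ ⟩
    (walks true true (suc n) + walks true false n) + (walks true true n + walks false false n)
      ≡⟨ cong₂ _+_ (closedWalks≡L (suc n)) (closedWalks≡L n) ⟩
    L (suc n) + L n ∎
    where
    open ≡-Reasoning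
    regroup : ∀ a b c d → a + b + (c + d) ≡ (a + c) + (b + d)
    regroup = solve-∀

  ClosedWalk↔Fin : ∀ n → ClosedWalk n ↔ Fin (L n)
  ClosedWalk↔Fin n = subst (λ k → ClosedWalk n ↔ Fin k) (closedWalks≡L n)
    (↔-trans split (↔-trans (Walk↔Fin true true n ⊎-↔ Walk↔Fin false false n) (↔-sym +↔⊎)))
    where
    split : ClosedWalk n ↔ (Walk true true n ⊎ Walk false false n)
    split = mk↔ₛ′
      (λ { (true , w) → inj₁ w ; (false , w) → inj₂ w })
      (λ { (inj₁ w) → true , w ; (inj₂ w) → false , w })
      (λ { (inj₁ w) → refl ; (inj₂ w) → refl })
      (λ { (true , w) → refl ; (false , w) → refl })

  -- Periodic covering words, split into cycles

  Periodic : ℕ → (ℕ → Bool) → Set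
  Periodic p s = ∀ t → s (t + p) ≡ s t

  Covering : ℕ → (ℕ → Bool) → Set
  Covering k s = ∀ t → s t ∨ s (t + k) ≡ true

  -- Pointwise equality replaces function extensionality, and the proofs of periodicity and covering
  -- are not compared, so each signal counts once.
  Words : ℕ → ℕ → Setoid 0ℓ 0ℓ
  Words p k = On.setoid {B = Σ (ℕ → Bool) λ s → Periodic p s × Covering k s} (ℕ →-setoid Bool) proj₁

  periodic-* : ∀ {p s} → Periodic p s → ∀ n t → s (t + n * p) ≡ s t
  periodic-* {p} {s} per zero    t = cong s (+-identityʳ t)
  periodic-* {p} {s} per (suc n) t = begin
    s (t + (p + n * p)) ≡⟨ cong s (+-assoc t p (n * p)) ⟨
    s (t + p + n * p)   ≡⟨ periodic-* per n (t + p) ⟩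
    s (t + p)           ≡⟨ per t ⟩
    s t                 ∎
    where open ≡-Reasoning

  -- Congruence modulo `p` without subtraction: `t` and `t′` agree after multiples of `p` are added
  -- on both sides. Below, each congruence is given by the two multipliers and a polynomial
  -- identity.
  periodic-≡ : ∀ {p s} → Periodic p s → ∀ {t t′} m n → t + m * p ≡ t′ + n * p → s t ≡ s t′
  periodic-≡ {s = s} per {t} {t′} m n eq =
    trans (sym (periodic-* per m t)) (trans (cong s eq) (periodic-* per n t′))

  Words-1≅ClosedWalk : ∀ m .{{_ : NonZero m}} → Inverse (Words m 1) (setoid (ClosedWalk m))
  Words-1≅ClosedWalk m@(suc m-1) = record
    { to        = to
    ; from      = from
    ; to-cong   = λ {x} {y} x≗y → closedWalk-ext (to x) (to y)
                    (λ {i} i≤m → trans (visit-to x i≤m) (trans (x≗y i) (sym (visit-to y i≤m))))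
    ; from-cong = λ { refl i → refl }
    ; inverse   = (λ {w} {x} x≗w → closedWalk-ext (to x) w (λ {i} i≤m →
                      trans (visit-to x i≤m) (trans (x≗w i) (from-visit w i≤m))))
                , (λ { {x} refl i → from-to x i })
    }
    where
    edges : ∀ u → Covering 1 u → ∀ i → u i ∨ u (suc i) ≡ true
    edges u cov i = subst (λ j → u i ∨ u j ≡ true) (+-comm i 1) (cov i)

    to : Setoid.Carrier (Words m 1) → ClosedWalk m
    to (u , per , cov) = u 0 , subst (λ b → Walk (u 0) b m) (per 0) (trace u (edges u cov) m)

    visit-to : ∀ (x : Setoid.Carrier (Words m 1)) {i} → i ≤ m → visit (proj₂ (to x)) i ≡ proj₁ x i
    visit-to (u , per , cov) {i} i≤m =
      trans (visit-subst (per 0) (trace u (edges u cov) m) i) (visit-trace u (edges u cov) i≤m)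

    wrap : ClosedWalk m → ℕ → Bool
    wrap (_ , w) i = visit w (i % m)

    from-visit : ∀ w {i} → i ≤ m → wrap w i ≡ visit (proj₂ w) i
    from-visit (a , w) {i} i≤m with m≤n⇒m<n∨m≡n i≤m
    ... | inj₁ i<m  = cong (visit w) (m<n⇒m%n≡m i<m)
    -- At i = m the index wraps to 0, and the two values agree because the walk is closed.
    ... | inj₂ refl = trans (cong (visit w) (n%n≡0 m)) (sym (visit-end w))

    wrap-edge : ∀ w i → wrap w i ∨ wrap w (i + 1) ≡ true
    wrap-edge (a , w) i = subst (λ b → visit w (i % m) ∨ b ≡ true) next (visit-edge w (m%n<n i m))
      where
      next : visit w (suc (i % m)) ≡ wrap (a , w) (i + 1)
      next = begin
        visit w (suc (i % m))     ≡⟨ from-visit (a , w) (m%n<n i m) ⟨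
        visit w (suc (i % m) % m) ≡⟨ cong (visit w) (cong (_% m) (+-comm 1 (i % m))) ⟩
        visit w ((i % m + 1) % m) ≡⟨ cong (visit w) ([m%d+n]%d≡[m+n]%d) ⟩
        visit w ((i + 1) % m)     ∎
        where
        open ≡-Reasoning
        [m%d+n]%d≡[m+n]%d : (i % m + 1) % m ≡ (i + 1) % m
        [m%d+n]%d≡[m+n]%d = trans (%-distribˡ-+ (i % m) 1 m)
          (trans (cong (λ z → (z + 1 % m) % m) (m%n%n≡m%n i m)) (sym (%-distribˡ-+ i 1 m)))

    from : ClosedWalk m → Setoid.Carrier (Words m 1)
    from w = wrap w , (λ t → cong (visit (proj₂ w)) ([m+n]%n≡m%n t m)) , wrap-edge w

    from-to : ∀ x i → wrap (to x) i ≡ proj₁ x i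
    from-to x@(u , per , _) i = trans (visit-to x (m%n≤n i m))
      (periodic-≡ per (i / m) 0 (trans (sym (m≡m%n+[m/n]*n i m)) (sym (+-identityʳ i))))

  Words-1-cardinality : ∀ m .{{_ : NonZero m}} → HasCardinality (Words m 1) (L m)
  Words-1-cardinality m = Composition.inverse (Words-1≅ClosedWalk m) (ClosedWalk↔Fin m)

  -- The last hypothesis says that c inverts k modulo m; the summand m keeps
  -- the equation in ℕ.
  module Cycles (d m k c w : ℕ) .{{_ : NonZero d}} .{{_ : NonZero m}}
                (bézout : k * c + m ≡ 1 + w * m) where

    p = m * d
    ℓ = k * d

    Families : Setoid 0ℓ 0ℓ
    Families = Pointwise.setoid (Words m 1) d

    -- The starts 0, ..., d - 1 represent the cycles of the step +ℓ. Going round one takes `m`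
    -- steps, which advance time by m ℓ = k p; hence the multiplier `k`.
    restrict : Setoid.Carrier (Words p ℓ) → Setoid.Carrier Families
    restrict (s , per , cov) j = (λ i → s (toℕ j + i * ℓ))
      , (λ i → periodic-≡ per 0 k (lhs (toℕ j) i m k d))
      , (λ i → subst (λ t → s (toℕ j + i * ℓ) ∨ s t ≡ true) (step (toℕ j) i (k * d)) (cov (toℕ j + i * ℓ)))
      where
      lhs : ∀ j i m k d → j + (i + m) * (k * d) + 0 ≡ j + i * (k * d) + k * (m * d)
      lhs = solve-∀
      step : ∀ j i e → j + i * e + e ≡ j + (i + 1) * e
      step = solve-∀

    -- Since c ℓ ≡ d modulo p, the position t = t % d + (t / d) d is reached from
    -- t % d by (t / d) c steps of length ℓ.
    glue : Setoid.Carrier Families → ℕ → Bool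
    glue u t = proj₁ (u (t mod d)) (t / d * c)

    -- A multiple of `d` leaves the residue alone and moves only the quotient. The cases of use are
    -- n = m for the period p, n = k for the step ℓ, and n = i k for `i` such steps.
    glue-shift : ∀ u t n → glue u (t + n * d) ≡ proj₁ (u (t mod d)) ((t / d + n) * c)
    glue-shift u t n = cong₂ (λ j q → proj₁ (u j) (q * c))
      (toℕ-injective (trans (toℕ-fromℕ< _) (trans ([m+kn]%n≡m%n t n d) (sym (toℕ-fromℕ< _)))))
      (trans (+-distrib-/-∣ʳ t (n∣m*n n)) (cong (t / d +_) (m*n/n≡m n d)))

    glue-periodic : ∀ u → Periodic p (glue u)
    glue-periodic u t = trans (glue-shift u t m) (periodic-≡ (proj₁ (proj₂ (u (t mod d)))) 0 c (eq (t / d) m c))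
      where
      eq : ∀ q m c → (q + m) * c + 0 ≡ q * c + c * m
      eq = solve-∀

    -- As k c ≡ 1 modulo m, a step of length ℓ, which raises the quotient by `k`, moves exactly one
    -- place along the cycle.
    [q+k]c≡qc+1 : ∀ {u} → Periodic m u → ∀ q → u ((q + k) * c) ≡ u (q * c + 1)
    [q+k]c≡qc+1 {u} per q = periodic-≡ per 1 w (begin
      (q + k) * c + 1 * m     ≡⟨ eq₁ q k c m ⟩
      q * c + (k * c + m)     ≡⟨ cong (q * c +_) bézout ⟩
      q * c + (1 + w * m)     ≡⟨ +-assoc (q * c) 1 (w * m) ⟨
      q * c + 1 + w * m       ∎)
      where
      open ≡-Reasoning
      eq₁ : ∀ q k c m → (q + k) * c + 1 * m ≡ q * c + (k * c + m)
      eq₁ = solve-∀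

    glue-covering : ∀ u → Covering ℓ (glue u)
    glue-covering u t = subst (λ b → glue u t ∨ b ≡ true)
      (sym (trans (glue-shift u t k) ([q+k]c≡qc+1 per (t / d)))) (cov (t / d * c))
      where
      per = proj₁ (proj₂ (u (t mod d)))
      cov = proj₂ (proj₂ (u (t mod d)))

    extend : Setoid.Carrier Families → Setoid.Carrier (Words p ℓ)
    extend u = glue u , glue-periodic u , glue-covering u

    restrict-extend : ∀ u (j : Fin d) i → glue u (toℕ j + i * ℓ) ≡ proj₁ (u j) i
    restrict-extend u j i = begin
      glue u (toℕ j + i * (k * d))                      ≡⟨ cong (λ z → glue u (toℕ j + z)) (*-assoc i k d) ⟨
      glue u (toℕ j + i * k * d)                        ≡⟨ glue-shift u (toℕ j) (i * k) ⟩
      proj₁ (u (toℕ j mod d)) ((toℕ j / d + i * k) * c) ≡⟨ cong₂ (λ j q → proj₁ (u j) ((q + i * k) * c)) j-mod (m<n⇒m/n≡0 (toℕ<n j)) ⟩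
      proj₁ (u j) (i * k * c)                           ≡⟨ periodic-≡ (proj₁ (proj₂ (u j))) i (i * w) eq ⟩
      proj₁ (u j) i                                     ∎
      where
      open ≡-Reasoning
      j-mod : toℕ j mod d ≡ j
      j-mod = toℕ-injective (trans (toℕ-fromℕ< _) (m<n⇒m%n≡m (toℕ<n j)))
      eq₁ : ∀ i k c m → i * k * c + i * m ≡ i * (k * c + m)
      eq₁ = solve-∀
      eq₂ : ∀ i w m → i * (1 + w * m) ≡ i + i * w * m
      eq₂ = solve-∀
      eq : i * k * c + i * m ≡ i + i * w * m
      eq = trans (eq₁ i k c m) (trans (cong (i *_) bézout) (eq₂ i w m))

    extend-restrict : ∀ x t → glue (restrict x) t ≡ proj₁ x t
    -- The multipliers `q` and `q * w` come from multiplying the Bézout equation by `q * d`.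
    extend-restrict (s , per , _) t = periodic-≡ per (t / d) (t / d * w) (begin
      toℕ (t mod d) + q * c * (k * d) + q * (m * d) ≡⟨ cong (λ z → z + q * c * (k * d) + q * (m * d)) (toℕ-fromℕ< _) ⟩
      t % d + q * c * (k * d) + q * (m * d)         ≡⟨ eq₁ (t % d) q c k d m ⟩
      t % d + q * d * (k * c + m)                   ≡⟨ cong (λ z → t % d + q * d * z) bézout ⟩
      t % d + q * d * (1 + w * m)                   ≡⟨ eq₂ (t % d) q d w m ⟩
      t % d + q * d + q * w * (m * d)               ≡⟨ cong (_+ q * w * (m * d)) (m≡m%n+[m/n]*n t d) ⟨
      t + q * w * (m * d)                           ∎)
      where
      open ≡-Reasoning
      q = t / d
      eq₁ : ∀ a q c k d m → a + q * c * (k * d) + q * (m * d) ≡ a + q * d * (k * c + m)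
      eq₁ = solve-∀
      eq₂ : ∀ a q d w m → a + q * d * (1 + w * m) ≡ a + q * d + q * w * (m * d)
      eq₂ = solve-∀

    Words≅Families : Inverse (Words p ℓ) Families
    Words≅Families = record
      { to        = restrict
      ; from      = extend
      ; to-cong   = λ x≗y j i → x≗y (toℕ j + i * ℓ)
      ; from-cong = λ u≗v t → u≗v (t mod d) (t / d * c)
      ; inverse   = (λ {u} {x} x≗u j i → trans (x≗u (toℕ j + i * ℓ)) (restrict-extend u j i))
                  , (λ {x} {u} u≗x t → trans (u≗x (t mod d) (t / d * c)) (extend-restrict x t))
      }

  power-cardinality : ∀ {S : Setoid 0ℓ 0ℓ} {n} → HasCardinality S n →
                      ∀ d → HasCardinality (Pointwise.setoid S d) (n ^ d)
  power-cardinality {S} {n} S≅n d = record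
    { to        = λ f → funToFin (to ∘ f)
    ; from      = λ i → from ∘ finToFun i
    ; to-cong   = λ f≈g → funToFin-cong (λ j → to-cong (f≈g j))
    ; from-cong = λ { refl j → S.refl }
    ; inverse   = (λ {i} {f} f≈i → trans (funToFin-cong (λ j → inverseˡ (f≈i j))) (funToFin-finToFin {d} {n} i))
                , (λ { {f} refl j → inverseʳ (finToFun-funToFin (to ∘ f) j) })
    }
    where
    open Inverse S≅n
    module S = Setoid S
    funToFin-cong : ∀ {m n} {f g : Fin m → Fin n} → f ≗ g → funToFin f ≡ funToFin g
    funToFin-cong {zero}  f≗g = refl
    funToFin-cong {suc m} f≗g = cong₂ combine (f≗g zero) (funToFin-cong (f≗g ∘ suc))

  -- Division of the gcd identity by `d` yields an inverse of `k` modulo `m`, up to a sign that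
  -- depends on which side of the identity carries `k * d`.
  quotient-bézout : ∀ {d m k} .{{_ : NonZero d}} .{{_ : NonZero m}} →
                    Bézout.Identity d (k * d) (m * d) → ∃[ c ] ∃[ w ] k * c + m ≡ 1 + w * m
  quotient-bézout {d} {m} {k} (Bézout.+- x y eq) = x , 1 + y , *-cancelʳ-≡ _ _ d (begin
    (k * x + m) * d            ≡⟨ eq₁ k x m d ⟩
    x * (k * d) + m * d        ≡⟨ cong (_+ m * d) eq ⟨
    d + y * (m * d) + m * d    ≡⟨ eq₂ d y m ⟩
    (1 + (1 + y) * m) * d      ∎)
    where
    open ≡-Reasoning
    eq₁ : ∀ k x m d → (k * x + m) * d ≡ x * (k * d) + m * d
    eq₁ = solve-∀
    eq₂ : ∀ d y m → d + y * (m * d) + m * d ≡ (1 + (1 + y) * m) * d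
    eq₂ = solve-∀
  -- Here k x ≡ -1 modulo m. Multiplying by m - 1, which is -1 modulo m, corrects the sign.
  quotient-bézout {d} {m@(suc m-1)} {k} (Bézout.-+ x y eq) = x * m-1 , y * m-1 , *-cancelʳ-≡ _ _ d (begin
    (k * (x * m-1) + m) * d           ≡⟨ eq₁ k x m-1 d ⟩
    d + m-1 * (d + x * (k * d))       ≡⟨ cong (λ z → d + m-1 * z) eq ⟩
    d + m-1 * (y * (m * d))           ≡⟨ eq₂ d m-1 y m ⟩
    (1 + y * m-1 * m) * d             ∎)
    where
    open ≡-Reasoning
    eq₁ : ∀ k x n d → (k * (x * n) + (1 + n)) * d ≡ d + n * (d + x * (k * d))
    eq₁ = solve-∀
    eq₂ : ∀ d n y m → d + n * (y * (m * d)) ≡ (1 + y * n * m) * d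
    eq₂ = solve-∀

  Words-cardinality : ∀ p ℓ .{{_ : NonZero p}} → HasCardinality (Words p ℓ) (CΔ ℓ p)
  Words-cardinality p ℓ = subst₂ (λ p′ ℓ′ → HasCardinality (Words p′ ℓ′) (CΔ ℓ p)) p≡md ℓ≡kd
    (Composition.inverse Words≅Families (power-cardinality (Words-1-cardinality m) d))
    where
    d = gcd ℓ p
    instance
      d≢0 : NonZero d
      d≢0 = Δ-nonZero ℓ p
    m = p / d
    k = ℓ / d
    p≡md : m * d ≡ p
    p≡md = m/n*n≡m (gcd[m,n]∣n ℓ p)
    ℓ≡kd : k * d ≡ ℓ
    ℓ≡kd = m/n*n≡m (gcd[m,n]∣m ℓ p)
    instance
      m≢0 : NonZero m
      m≢0 = m*n≢0⇒m≢0 m {d} {{subst NonZero (sym p≡md) it}}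
    identity : Bézout.Identity d (k * d) (m * d)
    identity = subst₂ (Bézout.Identity d) (sym ℓ≡kd) (sym p≡md) (Bézout.identity (gcd-GCD ℓ p))
    coefficients = quotient-bézout {d} {m} {k} identity
    open Cycles d m k (proj₁ coefficients) (proj₁ (proj₂ coefficients)) (proj₂ (proj₂ coefficients)) using (Words≅Families)

-- The circuit and the signal of its node 0

module CircuitSignals where

  open import Data.Nat.Base using (_*_)
  open CyclicWords
  open import Data.Vec.Base using (Vec; []; _∷_; head; last; take; drop; lookup; tabulate)
  open import Data.Vec.Properties using (lookup∘tabulate; tabulate∘lookup; tabulate-cong; take++drop≡id; lookup-++ˡ; lookup-++ʳ)

  module _ {A : Set} (f : A → A) where

    iterate-+ : ∀ x m n → iterate f x (m + n) ≡ iterate f (iterate f x m) n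
    iterate-+ x zero    n = refl
    iterate-+ x (suc m) n = iterate-+ (f x) m n

    iterate-suc : ∀ x n → iterate f x (suc n) ≡ f (iterate f x n)
    iterate-suc x zero    = refl
    iterate-suc x (suc n) = iterate-suc (f x) n

    iterate-* : ∀ {x p} → iterate f x p ≡ x → ∀ n → iterate f x (n * p) ≡ x
    iterate-* per zero = refl
    iterate-* {x} {p} per (suc n) =
      trans (iterate-+ x p (n * p)) (trans (cong (λ y → iterate f y (n * p)) per) (iterate-* per n))

    iterate-+-* : ∀ {x p} → iterate f x p ≡ x → ∀ n t → iterate f x (t + n * p) ≡ iterate f x t
    iterate-+-* {x} {p} per n t = begin
      iterate f x (t + n * p)             ≡⟨ cong (iterate f x) (+-comm t (n * p)) ⟩
      iterate f x (n * p + t)             ≡⟨ iterate-+ x (n * p) t ⟩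
      iterate f (iterate f x (n * p)) t   ≡⟨ cong (λ y → iterate f y t) (iterate-* per n) ⟩
      iterate f x t                       ∎
      where open ≡-Reasoning

  lookup-zero : ∀ {n} (x : Vec Bool (suc n)) → lookup x zero ≡ head x
  lookup-zero (_ ∷ _) = refl

  lookup-injective : ∀ {n} {x y : Vec Bool n} → lookup x ≗ lookup y → x ≡ y
  lookup-injective {x = x} {y} x≗y =
    trans (sym (tabulate∘lookup x)) (trans (tabulate-cong x≗y) (tabulate∘lookup y))

  last-lookup : ∀ {n} (x : Vec Bool (suc n)) → last x ≡ lookup x (fromℕ n)
  last-lookup {zero}  (_ ∷ []) = refl
  last-lookup {suc n} (_ ∷ x)  = last-lookup x

  lookup-take : ∀ m {n} (x : Vec Bool (m + n)) i → lookup (take m x) i ≡ lookup x (i ↑ˡ n)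
  lookup-take m x i =
    trans (sym (lookup-++ˡ (take m x) (drop m x) i)) (cong (λ y → lookup y _) (take++drop≡id m x))

  lookup-drop : ∀ m {n} (x : Vec Bool (m + n)) i → lookup (drop m x) i ≡ lookup x (m ↑ʳ i)
  lookup-drop m x i =
    trans (sym (lookup-++ʳ (take m x) (drop m x) i)) (cong (λ y → lookup y _) (take++drop≡id m x))

  if-yes : ∀ {P A : Set} (P? : Dec P) {x y : A} → P → (if does P? then x else y) ≡ x
  if-yes P? p = cong (if_then _ else _) (dec-true P? p)

  if-no : ∀ {P A : Set} (P? : Dec P) {x y : A} → ¬ P → (if does P? then x else y) ≡ y
  if-no P? ¬p = cong (if_then _ else _) (dec-false P? ¬p)

  -- If `a` is false, the update returns true and the equation forces `b`; if `a` is true, the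
  -- update returns `b` and imposes nothing.
  ≡not∨⇒∨ : ∀ {a b} → b ≡ not a ∨ b → a ∨ b ≡ true
  ≡not∨⇒∨ {true}  _  = refl
  ≡not∨⇒∨ {false} eq = eq

  ∨⇒not∨≡ : ∀ {a b} → a ∨ b ≡ true → not a ∨ b ≡ b
  ∨⇒not∨≡ {true}  _    = refl
  ∨⇒not∨≡ {false} refl = refl

  module Circuit (l s : ℕ) where

    ℓ r : ℕ
    ℓ = suc l
    r = suc s

    Node : Set
    Node = Fin (ℓ + s)

    step : Config ℓ r → Config ℓ r
    step = F ℓ r

    -- The time that the state of node 0 takes to reach node j.
    depth : ℕ → ℕ
    depth zero    = 0
    depth (suc j) = if does (suc j ≟ ℓ) then 1 else suc (depth j)

    depth-ℓ : ∀ {j} → suc j ≡ ℓ → depth (suc j) ≡ 1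
    depth-ℓ {j} = if-yes (suc j ≟ ℓ)

    depth-suc : ∀ {j} → suc j ≢ ℓ → depth (suc j) ≡ suc (depth j)
    depth-suc {j} = if-no (suc j ≟ ℓ)

    depth-left : ∀ j → j ≤ l → depth j ≡ j
    depth-left zero    _     = refl
    depth-left (suc j) j+1≤l =
      trans (depth-suc (<⇒≢ (s≤s j+1≤l))) (cong suc (depth-left j (<⇒≤ j+1≤l)))

    depth-right : ∀ j → depth (ℓ + j) ≡ suc j
    depth-right zero    = depth-ℓ (+-identityʳ ℓ)
    depth-right (suc j) = trans (depth-suc (m+1+n≢m ℓ))
      (cong suc (trans (cong depth (+-suc l j)) (depth-right j)))

    last-xᴸ : ∃[ i ] depth (toℕ i) ≡ l × (∀ x → last (xᴸ ℓ r x) ≡ lookup x i)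
    last-xᴸ = fromℕ l ↑ˡ s
      , trans (cong depth (trans (toℕ-↑ˡ (fromℕ l) s) (toℕ-fromℕ l))) (depth-left l ≤-refl)
      , λ x → trans (last-lookup (take ℓ x)) (lookup-take ℓ x (fromℕ l))

    last-xᴿ : ∃[ i ] depth (toℕ i) ≡ s × (∀ x → last (xᴿ ℓ r x) ≡ lookup x i)
    last-xᴿ = helper s
      where
      helper : ∀ s → ∃[ i ] depth (toℕ {ℓ + s} i) ≡ s × (∀ x → last (xᴿ ℓ (suc s) x) ≡ lookup x i)
      -- For r = 1 the right-circuit is node 0 alone, so its last entry has depth 0.
      helper zero    = zero , refl , λ x → trans (last-lookup (head x ∷ drop ℓ x)) (sym (lookup-zero x))
      helper (suc s) = ℓ ↑ʳ fromℕ s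
        , trans (cong depth (trans (toℕ-↑ʳ ℓ (fromℕ s)) (cong (ℓ +_) (toℕ-fromℕ s)))) (depth-right s)
        , λ x → trans (last-lookup (head x ∷ drop ℓ x)) (lookup-drop ℓ x (fromℕ s))

    signal : Config ℓ r → ℕ → Bool
    signal x t = head (iterate step x t)

    step-suc : ∀ x (i : Fin (l + s)) →
               lookup (step x) (suc i) ≡ (if does (suc (toℕ i) ≟ ℓ) then head x else lookup x (inject₁ i))
    step-suc x = lookup∘tabulate λ j → if does (suc (toℕ j) ≟ ℓ) then head x else lookup x (inject₁ j)

    -- Each node other than 0 copies an earlier one with delay 1, so the signal travels along the
    -- numbering; at node ℓ the copy is taken from node 0 and the delay restarts at 1.
    lookup-iterate : ∀ x t (i : Node) → lookup (iterate step x (t + depth (toℕ i))) i ≡ signal x t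
    lookup-iterate x t = <-weakInduction Q
      (trans (lookup-zero (iterate step x (t + 0))) (cong (signal x) (+-identityʳ t))) next
      where
      Q : Node → Set
      Q i = lookup (iterate step x (t + depth (toℕ i))) i ≡ signal x t

      next : ∀ i → Q (inject₁ i) → Q (suc i)
      next i ih rewrite toℕ-inject₁ i with suc (toℕ i) ≟ ℓ
      ... | yes i+1≡ℓ = begin
        lookup (iterate step x (t + depth (suc (toℕ i)))) (suc i) ≡⟨ cong (λ n → lookup (iterate step x (t + n)) (suc i)) (depth-ℓ i+1≡ℓ) ⟩
        lookup (iterate step x (t + 1)) (suc i)             ≡⟨ cong (λ n → lookup (iterate step x n) (suc i)) (+-comm t 1) ⟩
        lookup (iterate step x (suc t)) (suc i)             ≡⟨ cong (λ y → lookup y (suc i)) (iterate-suc step x t) ⟩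
        lookup (step (iterate step x t)) (suc i)            ≡⟨ step-suc (iterate step x t) i ⟩
        _                                                   ≡⟨ if-yes (suc (toℕ i) ≟ ℓ) i+1≡ℓ ⟩
        signal x t                                          ∎
        where open ≡-Reasoning
      ... | no i+1≢ℓ = begin
        lookup (iterate step x (t + depth (suc (toℕ i)))) (suc i)   ≡⟨ cong (λ n → lookup (iterate step x (t + n)) (suc i)) (depth-suc i+1≢ℓ) ⟩
        lookup (iterate step x (t + suc (depth (toℕ i)))) (suc i)   ≡⟨ cong (λ n → lookup (iterate step x n) (suc i)) (+-suc t (depth (toℕ i))) ⟩
        lookup (iterate step x (suc (t + depth (toℕ i)))) (suc i)   ≡⟨ cong (λ y → lookup y (suc i)) (iterate-suc step x (t + depth (toℕ i))) ⟩
        lookup (step (iterate step x (t + depth (toℕ i)))) (suc i)  ≡⟨ step-suc (iterate step x (t + depth (toℕ i))) i ⟩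
        _                                                     ≡⟨ if-no (suc (toℕ i) ≟ ℓ) i+1≢ℓ ⟩
        lookup (iterate step x (t + depth (toℕ i))) (inject₁ i)     ≡⟨ ih ⟩
        signal x t                                            ∎
        where open ≡-Reasoning

    module _ (p-1 : ℕ) where

      p : ℕ
      p = suc p-1

      signal-periodic : ∀ {x} → HasPeriod ℓ r p x → Periodic p (signal x)
      signal-periodic {x} per t = cong head
        (trans (cong (λ n → iterate step x (t + n)) (sym (*-identityˡ p))) (iterate-+-* step per 1 t))

      -- Multiplication by p-1 is negation modulo p: node i holds σ (t − depth i).
      unroll : (ℕ → Bool) → ℕ → Config ℓ r
      unroll σ t = tabulate λ i → σ (t + depth (toℕ i) * p-1)

      lookup-unroll : ∀ σ t {i d} → depth (toℕ i) ≡ d → lookup (unroll σ t) i ≡ σ (t + d * p-1)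
      lookup-unroll σ t {i} refl = lookup∘tabulate (λ i → σ (t + depth (toℕ i) * p-1)) i

      -- By `lookup-iterate`, node i of the unrolled signal is node i of `x` at time depth · (p - 1)
      -- + depth = depth · p, a multiple of the period.
      unroll-signal : ∀ {x} → HasPeriod ℓ r p x → unroll (signal x) 0 ≡ x
      unroll-signal {x} per = lookup-injective λ i → begin
        lookup (unroll (signal x) 0) i                                        ≡⟨ lookup-unroll (signal x) 0 {i} refl ⟩
        signal x (depth (toℕ i) * p-1)                                        ≡⟨ lookup-iterate x (depth (toℕ i) * p-1) i ⟨
        lookup (iterate step x (depth (toℕ i) * p-1 + depth (toℕ i))) i       ≡⟨ cong (λ t → lookup (iterate step x t) i) (eq (depth (toℕ i)) p-1) ⟩
        lookup (iterate step x (depth (toℕ i) * p)) i                         ≡⟨ cong (λ y → lookup y i) (iterate-* step per (depth (toℕ i))) ⟩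
        lookup x i                                                            ∎
        where
        open ≡-Reasoning
        eq : ∀ d n → d * n + d ≡ d * suc n
        eq = solve-∀

      module _ (p∣r : p ∣ r) where

        e : ℕ
        e = quotient p∣r

        r≡ep : r ≡ e * p
        r≡ep = m∣n⇒n≡quotient*m p∣r

        signal-covering : ∀ {x} → HasPeriod ℓ r p x → Covering ℓ (signal x)
        signal-covering {x} per t = ≡not∨⇒∨ {signal x t} (begin
          signal x (t + ℓ)                                            ≡⟨ cong (signal x) (+-suc t l) ⟩
          signal x (suc (t + l))                                      ≡⟨ cong head (iterate-suc step x (t + l)) ⟩
          not (last (xᴸ ℓ r y)) ∨ last (xᴿ ℓ r y)                     ≡⟨ cong₂ (λ a b → not a ∨ b) left right ⟩
          not (signal x t) ∨ signal x (t + ℓ)                         ∎)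
          where
          open ≡-Reasoning
          y = iterate step x (t + l)
          left : last (xᴸ ℓ r y) ≡ signal x t
          left with i , depth≡l , last≡ ← last-xᴸ =
            trans (last≡ y) (trans (cong (λ n → lookup (iterate step x (t + n)) i) (sym depth≡l)) (lookup-iterate x t i))
          right : last (xᴿ ℓ r y) ≡ signal x (t + ℓ)
          -- Adding r = e p to the time changes nothing by periodicity, and t + l + r = t + ℓ + s is
          -- the moment when the node of depth `s` shows `signal x (t + ℓ)`.
          right with i , depth≡s , last≡ ← last-xᴿ = begin
            last (xᴿ ℓ r y)                                           ≡⟨ last≡ y ⟩
            lookup (iterate step x (t + l)) i                         ≡⟨ cong (λ z → lookup z i) (iterate-+-* step per e (t + l)) ⟨
            lookup (iterate step x (t + l + e * p)) i                 ≡⟨ cong (λ n → lookup (iterate step x (t + l + n)) i) r≡ep ⟨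
            lookup (iterate step x (t + l + r)) i                     ≡⟨ cong (λ n → lookup (iterate step x n) i) (eq t l s) ⟩
            lookup (iterate step x (t + ℓ + s)) i                     ≡⟨ cong (λ n → lookup (iterate step x (t + ℓ + n)) i) depth≡s ⟨
            lookup (iterate step x (t + ℓ + depth (toℕ i))) i         ≡⟨ lookup-iterate x (t + ℓ) i ⟩
            signal x (t + ℓ)                                          ∎
            where
            eq : ∀ t l s → t + l + suc s ≡ t + suc l + s
            eq = solve-∀

        module _ {σ : ℕ → Bool} (per : Periodic p σ) (cov : Covering ℓ σ) where

          -- Raising time and depth by one each adds 1 + (p - 1) = p to the argument of `σ`, which
          -- settles every node but 0. At node 0 the covering condition takes over.
          step-unroll : ∀ t → step (unroll σ t) ≡ unroll σ (suc t)
          step-unroll t = lookup-injective λ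
            { zero    → trans head-case (sym (lookup-unroll σ (suc t) {zero} refl))
            ; (suc i) → trans (step-suc (unroll σ t) i) (trans (tail-case i) (sym (lookup-unroll σ (suc t) {suc i} refl)))
            }
            where
            -- This is covering at t - l, whose partner is t - l + ℓ = t + 1.
            left : σ (t + l * p-1) ∨ σ (suc t + 0) ≡ true
            left = trans (cong (σ (t + l * p-1) ∨_) (periodic-≡ per l 0 (eq t l p-1))) (cov (t + l * p-1))
              where
              eq : ∀ t l n → suc t + 0 + l * suc n ≡ t + l * n + suc l + 0
              eq = solve-∀

            -- Since s = r - 1 ≡ -1 modulo p, t - s is t + 1: the end of the right-circuit already
            -- holds the next value of node 0.
            right : σ (t + s * p-1) ≡ σ (suc t + 0)
            right = periodic-≡ per e s
              (trans (cong (t + s * p-1 +_) (sym r≡ep)) (eq t s p-1))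
              where
              eq : ∀ t s n → t + s * n + suc s ≡ suc t + 0 + s * suc n
              eq = solve-∀

            head-case : not (last (xᴸ ℓ r (unroll σ t))) ∨ last (xᴿ ℓ r (unroll σ t)) ≡ σ (suc t + 0)
            head-case with i , depth≡l , last≡ᴸ ← last-xᴸ | j , depth≡s , last≡ᴿ ← last-xᴿ =
              trans (cong₂ (λ a b → not a ∨ b)
                      (trans (last≡ᴸ (unroll σ t)) (lookup-unroll σ t {i} depth≡l))
                      (trans (last≡ᴿ (unroll σ t)) (trans (lookup-unroll σ t {j} depth≡s) right)))
                    (∨⇒not∨≡ {σ (t + l * p-1)} left)

            tail-case : ∀ i → (if does (suc (toℕ i) ≟ ℓ) then head (unroll σ t) else lookup (unroll σ t) (inject₁ i))
                              ≡ σ (suc t + depth (suc (toℕ i)) * p-1)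
            tail-case i with suc (toℕ i) ≟ ℓ
            ... | yes i+1≡ℓ = trans (if-yes (suc (toℕ i) ≟ ℓ) i+1≡ℓ)
              (periodic-≡ per 1 0 (trans (eq t p-1) (cong (λ d → suc t + d * p-1 + 0) (sym (depth-ℓ i+1≡ℓ)))))
              where
              eq : ∀ t n → t + 0 + 1 * suc n ≡ suc t + 1 * n + 0
              eq = solve-∀
            ... | no  i+1≢ℓ = trans (if-no (suc (toℕ i) ≟ ℓ) i+1≢ℓ)
              (trans (lookup-unroll σ t {inject₁ i} (cong depth (toℕ-inject₁ i)))
                (periodic-≡ per 1 0 (trans (eq t (depth (toℕ i)) p-1) (cong (λ d → suc t + d * p-1 + 0) (sym (depth-suc i+1≢ℓ))))))
              where
              eq : ∀ t d n → t + d * n + 1 * suc n ≡ suc t + suc d * n + 0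
              eq = solve-∀

          iterate-unroll : ∀ t → iterate step (unroll σ 0) t ≡ unroll σ t
          iterate-unroll zero    = refl
          iterate-unroll (suc t) =
            trans (iterate-suc step (unroll σ 0) t) (trans (cong step (iterate-unroll t)) (step-unroll t))

          unroll-period : HasPeriod ℓ r p (unroll σ 0)
          unroll-period = trans (iterate-unroll p)
            (tabulate-cong λ i → trans (cong σ (+-comm p (depth (toℕ i) * p-1))) (per (depth (toℕ i) * p-1)))

          signal-unroll : ∀ t → signal (unroll σ 0) t ≡ σ t
          signal-unroll t = trans (cong head (iterate-unroll t)) (cong σ (+-identityʳ t))

        Configs≅Words : Inverse (ConfigsOfPeriod ℓ r p) (Words p ℓ)
        Configs≅Words = record
          { to        = λ (x , per) → signal x , signal-periodic per , signal-covering per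
          ; from      = λ (σ , per , cov) → unroll σ 0 , unroll-period per cov
          ; to-cong   = λ { refl t → refl }
          ; from-cong = λ σ≗τ → tabulate-cong λ i → σ≗τ (depth (toℕ i) * p-1)
          ; inverse   = (λ { {_ , per , cov} refl → signal-unroll per cov })
                      , (λ { {_ , per} σ≗x → trans (tabulate-cong λ i → σ≗x (depth (toℕ i) * p-1)) (unroll-signal per) })
          }

  ConfigsOfPeriod-cardinality : ∀ ℓ r p .{{_ : NonZero ℓ}} .{{_ : NonZero r}} .{{_ : NonZero p}} →
                                p ∣ r → HasCardinality (ConfigsOfPeriod ℓ r p) (CΔ ℓ p)
  ConfigsOfPeriod-cardinality ℓ@(suc l) (suc s) p@(suc p-1) p∣r =
    Composition.inverse (Circuit.Configs≅Words l s p-1 p∣r) (Words-cardinality p ℓ)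

-- Finite sums and the Möbius function

module MöbiusSums where

  open import Data.Nat.Base using (_*_; _/_)
  open import Algebra.Properties.CommutativeMonoid.Sum using (sum)
  open import Data.Integer.Base as ℤ using (ℤ; 0ℤ; 1ℤ; -1ℤ)
  open import Data.List.Base using (List; []; _∷_; _++_; length; map; filter; upTo; applyUpTo)
  open import Data.List.Membership.Propositional using (_∈_; _∉_)
  open import Data.List.Membership.Propositional.Properties
  open import Data.List.Membership.Propositional.Properties.WithK using (unique∧set⇒bag)
  open import Data.List.Relation.Binary.BagAndSetEquality using (∼bag⇒↭)
  open import Data.List.Relation.Binary.Permutation.Propositional as ↭ using (_↭_; ↭-sym; ↭⇒↭ₛ)
  open import Data.List.Relation.Binary.Permutation.Propositional.Properties using (↭-length)
  import Data.List.Relation.Binary.Permutation.Setoid.Properties as ↭ₛ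
  open import Data.List.Relation.Unary.All as All using (All; []; _∷_)
  import Data.List.Relation.Unary.All.Properties as All
  open import Data.List.Relation.Unary.AllPairs using ([]; _∷_)
  open import Data.List.Relation.Unary.Any using (here; there)
  open import Data.List.Relation.Unary.Unique.DecPropositional using (unique?)
  open import Data.List.Relation.Unary.Unique.Propositional using (Unique)
  import Data.List.Relation.Unary.Unique.Propositional.Properties as Unique
  open import Data.Nat.Coprimality using (coprime-divisor)
  open import Data.Nat.ListAction using (product)
  open import Data.Nat.ListAction.Properties using (∈⇒∣product)
  open import Data.Nat.Primality using (Prime; prime⇒irreducible; prime⇒nonZero)
  open import Data.Nat.Primality.Factorisation

  private variable
    A B : Set

  -- Sums run over lists, so that restriction is a `filter` and reindexing a permutation; `sum≡∑`
  -- connects them with the sum over `Fin` in the statement.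
  ∑ : (A → ℤ) → List A → ℤ
  ∑ f []       = 0ℤ
  ∑ f (x ∷ xs) = f x ℤ.+ ∑ f xs

  ∑-cong : ∀ {f g : A → ℤ} xs → (∀ {x} → x ∈ xs → f x ≡ g x) → ∑ f xs ≡ ∑ g xs
  ∑-cong []       eq = refl
  ∑-cong (x ∷ xs) eq = cong₂ ℤ._+_ (eq (here refl)) (∑-cong xs (eq ∘ there))

  ∑-0 : ∀ (xs : List A) → ∑ (λ _ → 0ℤ) xs ≡ 0ℤ
  ∑-0 []       = refl
  ∑-0 (x ∷ xs) = trans (ℤ.+-identityˡ _) (∑-0 xs)

  +-interchange : ∀ a b c d → (a ℤ.+ b) ℤ.+ (c ℤ.+ d) ≡ (a ℤ.+ c) ℤ.+ (b ℤ.+ d)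
  +-interchange a b c d = begin
    (a ℤ.+ b) ℤ.+ (c ℤ.+ d) ≡⟨ ℤ.+-assoc a b _ ⟩
    a ℤ.+ (b ℤ.+ (c ℤ.+ d)) ≡⟨ cong (ℤ._+_ a) (ℤ.+-assoc b c d) ⟨
    a ℤ.+ (b ℤ.+ c ℤ.+ d)   ≡⟨ cong (λ z → a ℤ.+ (z ℤ.+ d)) (ℤ.+-comm b c) ⟩
    a ℤ.+ (c ℤ.+ b ℤ.+ d)   ≡⟨ cong (ℤ._+_ a) (ℤ.+-assoc c b d) ⟩
    a ℤ.+ (c ℤ.+ (b ℤ.+ d)) ≡⟨ ℤ.+-assoc a c _ ⟨
    (a ℤ.+ c) ℤ.+ (b ℤ.+ d) ∎
    where open ≡-Reasoning

  ∑-+ : ∀ (f g : A → ℤ) xs → ∑ (λ x → f x ℤ.+ g x) xs ≡ ∑ f xs ℤ.+ ∑ g xs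
  ∑-+ f g []       = refl
  ∑-+ f g (x ∷ xs) = trans (cong (ℤ._+_ (f x ℤ.+ g x)) (∑-+ f g xs)) (+-interchange (f x) (g x) _ _)

  ∑-*ˡ : ∀ c (f : A → ℤ) xs → c ℤ.* ∑ f xs ≡ ∑ (λ x → c ℤ.* f x) xs
  ∑-*ˡ c f []       = ℤ.*-zeroʳ c
  ∑-*ˡ c f (x ∷ xs) = trans (ℤ.*-distribˡ-+ c (f x) _) (cong (ℤ._+_ (c ℤ.* f x)) (∑-*ˡ c f xs))

  ∑-++ : ∀ (f : A → ℤ) xs ys → ∑ f (xs ++ ys) ≡ ∑ f xs ℤ.+ ∑ f ys
  ∑-++ f []       ys = sym (ℤ.+-identityˡ _)
  ∑-++ f (x ∷ xs) ys = trans (cong (ℤ._+_ (f x)) (∑-++ f xs ys)) (sym (ℤ.+-assoc (f x) _ _))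

  ∑-map : ∀ (f : B → ℤ) (g : A → B) xs → ∑ f (map g xs) ≡ ∑ (f ∘ g) xs
  ∑-map f g []       = refl
  ∑-map f g (x ∷ xs) = cong (ℤ._+_ (f (g x))) (∑-map f g xs)

  ∑-swap : ∀ (f : A → B → ℤ) xs ys →
           ∑ (λ x → ∑ (f x) ys) xs ≡ ∑ (λ y → ∑ (λ x → f x y) xs) ys
  ∑-swap f []       ys = sym (∑-0 ys)
  ∑-swap f (x ∷ xs) ys =
    trans (cong (ℤ._+_ (∑ (f x) ys)) (∑-swap f xs ys)) (sym (∑-+ (f x) _ ys))

  ∑-filter : ∀ {P : Pred A 0ℓ} (P? : Decidable P) (f : A → ℤ) xs →
             ∑ f (filter P? xs) ≡ ∑ (λ x → if does (P? x) then f x else 0ℤ) xs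
  ∑-filter P? f []       = refl
  ∑-filter P? f (x ∷ xs) with does (P? x)
  ... | true  = cong (ℤ._+_ (f x)) (∑-filter P? f xs)
  ... | false = trans (∑-filter P? f xs) (sym (ℤ.+-identityˡ _))

  ∑-1 : ∀ (xs : List A) → ∑ (λ _ → 1ℤ) xs ≡ ℤ.+ length xs
  ∑-1 []       = refl
  ∑-1 (x ∷ xs) = cong (ℤ._+_ 1ℤ) (∑-1 xs)

  ∑-↭ : ∀ (f : A → ℤ) {xs ys} → xs ↭ ys → ∑ f xs ≡ ∑ f ys
  ∑-↭ f ↭.refl       = refl
  ∑-↭ f (↭.prep x p) = cong (ℤ._+_ (f x)) (∑-↭ f p)
  ∑-↭ f (↭.swap {xs} {ys} x y p) = begin
    f x ℤ.+ (f y ℤ.+ ∑ f xs) ≡⟨ ℤ.+-assoc (f x) (f y) _ ⟨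
    f x ℤ.+ f y ℤ.+ ∑ f xs   ≡⟨ cong₂ ℤ._+_ (ℤ.+-comm (f x) (f y)) (∑-↭ f p) ⟩
    f y ℤ.+ f x ℤ.+ ∑ f ys   ≡⟨ ℤ.+-assoc (f y) (f x) _ ⟩
    f y ℤ.+ (f x ℤ.+ ∑ f ys) ∎
    where open ≡-Reasoning
  ∑-↭ f (↭.trans p q)  = trans (∑-↭ f p) (∑-↭ f q)

  -- In a duplicate-free list an element occurs in at most one way, so equality as sets is already
  -- equality as bags. Reindexing and counting by bijection both rest on this.
  unique-⇔⇒↭ : ∀ {xs ys : List A} → Unique xs → Unique ys →
               (∀ {x} → x ∈ xs → x ∈ ys) → (∀ {x} → x ∈ ys → x ∈ xs) → xs ↭ ys
  unique-⇔⇒↭ xs! ys! ⊆ ⊇ = ∼bag⇒↭ (unique∧set⇒bag xs! ys! (mk⇔ ⊆ ⊇))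

  unique-map-∈ : ∀ {f : A → B} {xs} → (∀ {x y} → x ∈ xs → y ∈ xs → f x ≡ f y → x ≡ y) →
                 Unique xs → Unique (map f xs)
  unique-map-∈ {xs = []}     inj []           = []
  unique-map-∈ {xs = x ∷ xs} inj (x∉xs ∷ xs!) =
    All.map⁺ (All.tabulate λ y∈xs fx≡fy → All.lookup x∉xs y∈xs (inj (here refl) (there y∈xs) fx≡fy))
    ∷ unique-map-∈ (λ x∈xs y∈xs → inj (there x∈xs) (there y∈xs)) xs!

  sum≡∑ : ∀ {A : Set} (g : A → ℤ) (h : ℕ → A) n → sum ℤ.+-0-commutativeMonoid {n} (λ i → g (h (toℕ i))) ≡ ∑ g (applyUpTo h n)
  sum≡∑ g h zero    = refl
  sum≡∑ g h (suc n) = cong (ℤ._+_ (g (h 0))) (sum≡∑ g (h ∘ suc) n)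

  sign : List ℕ → ℤ
  sign ps = if does (unique? _≟_ ps) then -1ℤ ℤ.^ length ps else 0ℤ

  unique-resp-↭ : ∀ {xs ys : List ℕ} → xs ↭ ys → Unique xs → Unique ys
  unique-resp-↭ xs↭ys = ↭ₛ.Unique-resp-↭ (setoid ℕ) (↭⇒↭ₛ xs↭ys)

  sign-↭ : ∀ {ps qs} → ps ↭ qs → sign ps ≡ sign qs
  sign-↭ {ps} {qs} ps↭qs = cong₂ (λ b n → if b then -1ℤ ℤ.^ n else 0ℤ)
    (does-⇔ (mk⇔ (unique-resp-↭ ps↭qs) (unique-resp-↭ (↭-sym ps↭qs))) (unique? _≟_ ps) (unique? _≟_ qs))
    (↭-length ps↭qs)

  -- `μ` is defined through one chosen factorisation. Uniqueness up to order lets any other compute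
  -- it, in particular `p ∷ factors f` for `p * n`.
  μ≡sign : ∀ {n} .{{_ : NonZero n}} (f : PrimeFactorisation n) → μ n ≡ sign (factors f)
  μ≡sign {suc n} f = sign-↭ (factorisationUnique (factorise (suc n)) f)

  sign-∷-∈ : ∀ {p ps} → p ∈ ps → sign (p ∷ ps) ≡ 0ℤ
  sign-∷-∈ {p} {ps} p∈ps = cong (if_then -1ℤ ℤ.^ length (p ∷ ps) else 0ℤ)
    (dec-false (unique? _≟_ (p ∷ ps)) λ { (p∉ps ∷ _) → All.lookup p∉ps p∈ps refl })

  sign-∷-∉ : ∀ {p ps} → p ∉ ps → sign (p ∷ ps) ≡ ℤ.- sign ps
  sign-∷-∉ {p} {ps} p∉ps = trans
    (cong (if_then -1ℤ ℤ.^ length (p ∷ ps) else 0ℤ)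
      (does-⇔ (mk⇔ (λ { (_ ∷ ps!) → ps! }) (All.¬Any⇒All¬ ps p∉ps ∷_)) (unique? _≟_ (p ∷ ps)) (unique? _≟_ ps)))
    (negate (does (unique? _≟_ ps)))
    where
    negate : ∀ b → (if b then -1ℤ ℤ.^ length (p ∷ ps) else 0ℤ) ≡ ℤ.- (if b then -1ℤ ℤ.^ length ps else 0ℤ)
    negate true  = ℤ.-1*i≡-i (-1ℤ ℤ.^ length ps)
    negate false = refl

  module _ {p n} .{{_ : NonZero n}} (p-prime : Prime p) where

    private
      instance
        p≢0 : NonZero p
        p≢0 = prime⇒nonZero p-prime
        p*n≢0 : NonZero (p * n)
        p*n≢0 = m*n≢0 p n

      f = factorise n
      open PrimeFactorisation f using (isFactorisation; factorsPrime)

      f′ : PrimeFactorisation (p * n)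
      f′ = record
        { factors         = p ∷ factors f
        ; isFactorisation = cong (p *_) isFactorisation
        ; factorsPrime    = p-prime ∷ factorsPrime
        }

    μ-*-∣ : p ∣ n → μ (p * n) ≡ 0ℤ
    μ-*-∣ p∣n = trans (μ≡sign f′)
      (sign-∷-∈ (factorisationHasAllPrimeFactors p-prime (subst (p ∣_) isFactorisation p∣n) factorsPrime))

    μ-*-∤ : ¬ (p ∣ n) → μ (p * n) ≡ ℤ.- μ n
    μ-*-∤ p∤n = trans (μ≡sign f′) (trans
      (sign-∷-∉ {ps = factors f} λ p∈f → p∤n (subst (p ∣_) (sym isFactorisation) (∈⇒∣product p∈f)))
      (cong ℤ.-_ (sym (μ≡sign f))))

  -- Sums of μ over divisors

  divisors : ℕ → List ℕ
  divisors n = filter (_∣? n) (map suc (upTo n))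

  divisors-unique : ∀ n → Unique (divisors n)
  divisors-unique n = Unique.filter⁺ (_∣? n) (Unique.map⁺ suc-injective (Unique.upTo⁺ n))

  ∈-divisors⁺ : ∀ {d n} .{{_ : NonZero n}} → d ∣ n → d ∈ divisors n
  ∈-divisors⁺ {zero}  {n} d∣n = contradiction (0∣⇒≡0 d∣n) (≢-nonZero⁻¹ n)
  ∈-divisors⁺ {suc d} {n} d∣n = ∈-filter⁺ (_∣? n) (∈-map⁺ suc (∈-upTo⁺ (∣⇒≤ d∣n))) d∣n

  ∈-divisors⁻ : ∀ {d n} → d ∈ divisors n → d ∣ n
  ∈-divisors⁻ {n = n} d∈ = proj₂ (∈-filter⁻ (_∣? n) {xs = map suc (upTo n)} d∈)

  prime-divisor : ∀ n .{{_ : NonTrivial n}} → ∃[ p ] ∃[ m ] Prime p × n ≡ p * m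
  prime-divisor n@(2+ _) with factorise n
  ... | record { factors = [] ; isFactorisation = () }
  ... | record { factors = p ∷ ps ; isFactorisation = eq ; factorsPrime = p-prime ∷ _ } =
    p , product ps , p-prime , eq

  -- A divisor of p * m that is not a multiple of p already divides m.
  divisors-prime-* : ∀ {p m} .{{_ : NonZero m}} → Prime p →
                     divisors (p * m) ↭ filter (λ e → ¬? (p ∣? e)) (divisors m) ++ map (p *_) (divisors m)
  divisors-prime-* {p} {m} p-prime = unique-⇔⇒↭
    (divisors-unique (p * m))
    (Unique.++⁺ (Unique.filter⁺ _ (divisors-unique m)) (Unique.map⁺ (*-cancelˡ-≡ _ _ p) (divisors-unique m))
      λ (e∈l , e∈r) → proj₂ (∈-filter⁻ ∤p? {xs = divisors m} e∈l) (p∣-right e∈r))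
    to from
    where
    instance
      p≢0 : NonZero p
      p≢0 = prime⇒nonZero p-prime
      p*m≢0 : NonZero (p * m)
      p*m≢0 = m*n≢0 p m

    ∤p? : ∀ e → Dec (¬ (p ∣ e))
    ∤p? e = ¬? (p ∣? e)

    p∣-right : ∀ {e} → e ∈ map (p *_) (divisors m) → p ∣ e
    p∣-right e∈ with e′ , _ , refl ← ∈-map⁻ (p *_) e∈ = m∣m*n e′

    to : ∀ {e} → e ∈ divisors (p * m) → e ∈ filter ∤p? (divisors m) ++ map (p *_) (divisors m)
    to {e} e∈ with p ∣? e
    ... | yes (divides e′ refl) = ∈-++⁺ʳ (filter ∤p? (divisors m))
      (subst (_∈ map (p *_) (divisors m)) (*-comm p e′)
        (∈-map⁺ (p *_) (∈-divisors⁺ (*-cancelˡ-∣ p (subst (_∣ p * m) (*-comm e′ p) (∈-divisors⁻ e∈))))))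
    ... | no p∤e = ∈-++⁺ˡ (∈-filter⁺ ∤p? (∈-divisors⁺ (coprime-divisor coprime (∈-divisors⁻ e∈))) p∤e)
      where
      coprime : ∀ {d} → d ∣ e × d ∣ p → d ≡ 1
      coprime (d∣e , d∣p) with prime⇒irreducible p-prime d∣p
      ... | inj₁ d≡1  = d≡1
      ... | inj₂ refl = contradiction d∣e p∤e

    from : ∀ {e} → e ∈ filter ∤p? (divisors m) ++ map (p *_) (divisors m) → e ∈ divisors (p * m)
    from e∈ with ∈-++⁻ (filter ∤p? (divisors m)) e∈
    ... | inj₁ e∈l = ∈-divisors⁺ (∣n⇒∣m*n p (∈-divisors⁻ (proj₁ (∈-filter⁻ ∤p? {xs = divisors m} e∈l))))
    ... | inj₂ e∈r with e′ , e′∈ , refl ← ∈-map⁻ (p *_) e∈r = ∈-divisors⁺ (*-monoʳ-∣ p (∈-divisors⁻ e′∈))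

  -- Write n = p m. For e ∣ m with p ∤ e the terms μ(e) and μ(p e) = -μ(e) cancel; for p ∣ e only
  -- μ(p e) = 0 is present.
  ∑-μ-nonTrivial : ∀ n .{{_ : NonTrivial n}} → ∑ μ (divisors n) ≡ 0ℤ
  ∑-μ-nonTrivial n with p , m , p-prime , refl ← prime-divisor n = begin
    ∑ μ (divisors (p * m))
      ≡⟨ ∑-↭ μ (divisors-prime-* p-prime) ⟩
    ∑ μ (filter ∤p? (divisors m) ++ map (p *_) (divisors m))
      ≡⟨ ∑-++ μ (filter ∤p? (divisors m)) _ ⟩
    ∑ μ (filter ∤p? (divisors m)) ℤ.+ ∑ μ (map (p *_) (divisors m))
      ≡⟨ cong₂ ℤ._+_ (∑-filter ∤p? μ (divisors m)) (∑-map μ (p *_) (divisors m)) ⟩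
    ∑ (λ e → if does (∤p? e) then μ e else 0ℤ) (divisors m) ℤ.+ ∑ (λ e → μ (p * e)) (divisors m)
      ≡⟨ ∑-+ _ _ (divisors m) ⟨
    ∑ (λ e → (if does (∤p? e) then μ e else 0ℤ) ℤ.+ μ (p * e)) (divisors m)
      ≡⟨ ∑-cong (divisors m) (λ e∈ → cancel (∈-divisors⁻ e∈)) ⟩
    ∑ (λ _ → 0ℤ) (divisors m)
      ≡⟨ ∑-0 (divisors m) ⟩
    0ℤ ∎
    where
    open ≡-Reasoning
    instance
      m≢0 : NonZero m
      m≢0 = m*n≢0⇒n≢0 p {{nonTrivial⇒nonZero n}}

    ∤p? : ∀ e → Dec (¬ (p ∣ e))
    ∤p? e = ¬? (p ∣? e)

    cancel : ∀ {e} → e ∣ m → (if does (∤p? e) then μ e else 0ℤ) ℤ.+ μ (p * e) ≡ 0ℤ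
    cancel {zero}  0∣m = contradiction (0∣⇒≡0 0∣m) (≢-nonZero⁻¹ m)
    cancel {e@(suc _)} _ with p ∣? e
    ... | yes p∣e = trans (ℤ.+-identityˡ _) (μ-*-∣ p-prime p∣e)
    ... | no  p∤e = trans (cong (ℤ._+_ (μ e)) (μ-*-∤ p-prime p∤e)) (ℤ.+-inverseʳ (μ e))

  ∑-μ : ∀ n .{{_ : NonZero n}} → ∑ μ (divisors n) ≡ (if does (n ≟ 1) then 1ℤ else 0ℤ)
  ∑-μ 1        = refl
  ∑-μ n@(2+ _) = ∑-μ-nonTrivial n

  -- The map q ↦ p/q, with q = suc i, carries the q satisfying d ∣ q ∣ p onto the divisors of p/d.
  ∑-μ-multiples : ∀ p {d} .{{_ : NonZero p}} → d ∣ p →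
    ∑ (λ i → if does (suc i ∣? p) ∧ does (d ∣? suc i) then μ (p / suc i) else 0ℤ) (upTo p)
      ≡ (if does (d ≟ p) then 1ℤ else 0ℤ)
  ∑-μ-multiples p {d} d∣p = begin
    _                                                  ≡⟨ ∑-filter between? (λ i → μ (p / suc i)) (upTo p) ⟨
    ∑ (λ i → μ (p / suc i)) (filter between? (upTo p)) ≡⟨ ∑-map μ (λ i → p / suc i) (filter between? (upTo p)) ⟨
    ∑ μ (map (λ i → p / suc i) (filter between? (upTo p)))
      ≡⟨ ∑-↭ μ (unique-⇔⇒↭ (unique-map-∈ injective (Unique.filter⁺ between? (Unique.upTo⁺ p))) (divisors-unique (p / d)) to from) ⟩
    ∑ μ (divisors (p / d))                             ≡⟨ ∑-μ (p / d) ⟩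
    (if does (p / d ≟ 1) then 1ℤ else 0ℤ)              ≡⟨ cong (if_then 1ℤ else 0ℤ) (does-⇔ (mk⇔ p/d≡1⇒d≡p d≡p⇒p/d≡1) (p / d ≟ 1) (d ≟ p)) ⟩
    (if does (d ≟ p) then 1ℤ else 0ℤ)                  ∎
    where
    open ≡-Reasoning

    factor≢0 : ∀ {a} → a ∣ p → NonZero a
    factor≢0 {zero}  0∣p = contradiction (0∣⇒≡0 0∣p) (≢-nonZero⁻¹ p)
    factor≢0 {suc _} _   = _

    instance
      d≢0 : NonZero d
      d≢0 = factor≢0 d∣p
      p/d≢0 : NonZero (p / d)
      p/d≢0 = factor≢0 (m/n∣m d∣p)

    between? : ∀ i → Dec (suc i ∣ p × d ∣ suc i)
    between? i = (suc i ∣? p) ×-dec (d ∣? suc i)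

    between : ∀ {i} → i ∈ filter between? (upTo p) → suc i ∣ p × d ∣ suc i
    between i∈ = proj₂ (∈-filter⁻ between? {xs = upTo p} i∈)

    injective : ∀ {i j} → i ∈ filter between? (upTo p) → j ∈ filter between? (upTo p) →
                p / suc i ≡ p / suc j → i ≡ j
    injective {i} {j} i∈ j∈ eq = suc-injective (*-cancelˡ-≡ (suc i) (suc j) (p / suc i) {{factor≢0 (m/n∣m i∣p)}} (begin
      p / suc i * suc i ≡⟨ m/n*n≡m i∣p ⟩
      p                 ≡⟨ m/n*n≡m j∣p ⟨
      p / suc j * suc j ≡⟨ cong (_* suc j) eq ⟨
      p / suc i * suc j ∎))
      where
      i∣p = proj₁ (between i∈)
      j∣p = proj₁ (between j∈)

    to : ∀ {e} → e ∈ map (λ i → p / suc i) (filter between? (upTo p)) → e ∈ divisors (p / d)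
    to e∈ with i , i∈ , refl ← ∈-map⁻ (λ i → p / suc i) e∈ with i∣p , d∣i ← between i∈ =
      ∈-divisors⁺ (m*n∣o⇒m∣o/n (p / suc i) d (subst (p / suc i * d ∣_) (m/n*n≡m i∣p) (*-monoʳ-∣ (p / suc i) d∣i)))

    from : ∀ {e} → e ∈ divisors (p / d) → e ∈ map (λ i → p / suc i) (filter between? (upTo p))
    from {e} e∈ = cofactor (p / e) refl
      where
      ed∣p : e * d ∣ p
      ed∣p = m∣n/o⇒m*o∣n d∣p (∈-divisors⁻ e∈)
      e∣p : e ∣ p
      e∣p = m*n∣⇒m∣ e d ed∣p
      instance
        e≢0 : NonZero e
        e≢0 = factor≢0 e∣p
      -- The preimage of `e` is p/e, but the list is indexed by predecessors; generalising the
      -- quotient to `q` allows matching it as a successor.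
      cofactor : ∀ q → p / e ≡ q → e ∈ map (λ i → p / suc i) (filter between? (upTo p))
      cofactor zero    eq = contradiction eq (≢-nonZero⁻¹ (p / e) {{factor≢0 (m/n∣m e∣p)}})
      cofactor (suc i) eq = subst (_∈ map (λ i → p / suc i) (filter between? (upTo p))) p/i≡e
        (∈-map⁺ (λ i → p / suc i) (∈-filter⁺ between? (∈-upTo⁺ (∣⇒≤ i∣p)) (i∣p , d∣i)))
        where
        p≡e*i : p ≡ e * suc i
        p≡e*i = trans (sym (m*[n/m]≡n e∣p)) (cong (e *_) eq)
        i∣p : suc i ∣ p
        i∣p = divides e p≡e*i
        d∣i : d ∣ suc i
        d∣i = subst (d ∣_) eq (m*n∣o⇒n∣o/m e d ed∣p)
        p/i≡e : p / suc i ≡ e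
        p/i≡e = trans (cong (_/ suc i) p≡e*i) (m*n/n≡m e (suc i))

    p/d≡1⇒d≡p : p / d ≡ 1 → d ≡ p
    p/d≡1⇒d≡p eq = begin
      d         ≡⟨ *-identityˡ d ⟨
      1 * d     ≡⟨ cong (_* d) eq ⟨
      p / d * d ≡⟨ m/n*n≡m d∣p ⟩
      p         ∎

    d≡p⇒p/d≡1 : d ≡ p → p / d ≡ 1
    d≡p⇒p/d≡1 d≡p = trans (cong (_/ d) (sym d≡p)) (n/n≡1 d)

-- Counting periodic points and orbits

module PeriodicOrbits where

  open import Data.Nat.Base using (_*_; _/_)
  open CircuitSignals using (iterate-+; iterate-*; iterate-+-*)
  open MöbiusSums
  open import Data.Integer.Base as ℤ using (ℤ; 0ℤ; 1ℤ)
  open import Data.List.Base using (List; []; _∷_; length; filter; upTo; tabulate; lookup)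
  import Data.List.Membership.Setoid.Properties as Membership
  open import Data.List.Membership.Propositional using (_∈_)
  open import Data.List.Membership.Propositional.Properties
  open import Data.List.Properties using (length-tabulate)
  open import Data.List.Relation.Binary.Permutation.Propositional.Properties using (↭-length)
  open import Data.List.Relation.Unary.All as All using (All; []; _∷_)
  open import Data.List.Relation.Unary.All.Properties using (all-filter)
  open import Data.List.Relation.Unary.AllPairs using ([]; _∷_)
  open import Data.List.Relation.Unary.Any as Any using (Any; here; there)
  open import Data.List.Relation.Unary.Any.Properties using (lookup-index)
  open import Data.List.Relation.Unary.Unique.Propositional using (Unique)
  import Data.List.Relation.Unary.Unique.Propositional.Properties as Unique
  import Data.List.Relation.Unary.Unique.Setoid as Unique
  open import Data.List.Relation.Unary.Unique.DecSetoid.Properties using (deduplicate-!)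
  open import Data.Nat.Induction using (<-rec)
  open import Data.Rational.Base using () renaming (_/_ to _/ℚ_)
  open import Data.Rational.Properties using (fromℚᵘ-cong)
  open import Data.Rational.Unnormalised.Base using (mkℚᵘ; *≡*)
  open import Relation.Binary.Definitions using (DecidableEquality; tri<; tri≈; tri>)
  open import Relation.Unary.Relation.Binary.Equality using (≐-setoid)

  private variable
    a b : Level

  module _ (S : Setoid a b) where
    open Setoid S using (Carrier; _≈_)

    unique-lookup-injective : ∀ {xs} → Unique.Unique S xs → ∀ i j → lookup xs i ≈ lookup xs j → i ≡ j
    unique-lookup-injective (x∉xs ∷ xs!) zero    zero    eq = refl
    unique-lookup-injective (x∉xs ∷ xs!) (suc i) (suc j) eq = cong suc (unique-lookup-injective xs! i j eq)
    unique-lookup-injective {_ ∷ xs} (x∉xs ∷ xs!) zero (suc j) eq =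
      contradiction eq (All.lookup x∉xs (∈-lookup j))
    unique-lookup-injective {_ ∷ xs} (x∉xs ∷ xs!) (suc i) zero eq =
      contradiction (Setoid.sym S eq) (All.lookup x∉xs (∈-lookup i))

    enumeration-cardinality : ∀ {xs} → Unique.Unique S xs → (∀ x → Any (x ≈_) xs) →
                              HasCardinality S (length xs)
    enumeration-cardinality {xs} xs! complete = record
      { to        = index
      ; from      = lookup xs
      ; to-cong   = λ {x} {y} x≈y → injective (trans≈ (sym≈ (≈lookup x)) (trans≈ x≈y (≈lookup y)))
      ; from-cong = λ { refl → Setoid.refl S }
      ; inverse   = (λ {i} {x} x≈i → injective (trans≈ (sym≈ (≈lookup x)) x≈i))
                  , (λ { {x} refl → sym≈ (≈lookup x) })
      }
      where
      open Setoid S using () renaming (sym to sym≈; trans to trans≈)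
      injective : ∀ {i j} → lookup xs i ≈ lookup xs j → i ≡ j
      injective = unique-lookup-injective xs! _ _
      index : Carrier → Fin (length xs)
      index x = Any.index (complete x)
      ≈lookup : ∀ x → x ≈ lookup xs (index x)
      ≈lookup x = lookup-index (complete x)

  -- Counts a decidable subset through a parametrisation by `Fin n`; used for the points of period q
  -- and again for those of exact period p.
  length-filter≡ : ∀ {A : Set} {P : Pred A 0ℓ} (P? : Decidable P) {xs n} → Unique xs →
                   (g : Fin n → A) → (∀ {i j} → g i ≡ g j → i ≡ j) → (∀ i → g i ∈ xs) → (∀ i → P (g i)) →
                   (∀ {x} → P x → ∃[ i ] g i ≡ x) → length (filter P? xs) ≡ n
  length-filter≡ P? {xs} xs! g g-inj g∈ g-P g-onto = trans
    (↭-length (unique-⇔⇒↭ (Unique.filter⁺ P? xs!) (Unique.tabulate⁺ g-inj) to from))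
    (length-tabulate g)
    where
    to : ∀ {x} → x ∈ filter P? xs → x ∈ tabulate g
    to x∈ with i , refl ← g-onto (proj₂ (∈-filter⁻ P? {xs = xs} x∈)) = ∈-tabulate⁺ i
    from : ∀ {x} → x ∈ tabulate g → x ∈ filter P? xs
    from x∈ with i , refl ← ∈-tabulate⁻ x∈ = ∈-filter⁺ P? (g∈ i) (g-P i)

  -- The argument concerns an arbitrary map with known numbers of periodic points. At f = `F ℓ r`
  -- the notions below unfold to those of the statement.
  module Dynamics {A : Set} (_≟ᴬ_ : DecidableEquality A) (f : A → A) where

    Period : ℕ → Pred A 0ℓ
    Period p x = iterate f x p ≡ x

    ExactPeriod : ℕ → Pred A 0ℓ
    ExactPeriod p x = Period p x × (∀ d → 0 < d → d < p → ¬ Period d x)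

    Orbitᶠ : A → Pred A 0ℓ
    Orbitᶠ x y = ∃[ t ] iterate f x t ≡ y

    PeriodPoints : ℕ → Setoid 0ℓ 0ℓ
    PeriodPoints p = On.setoid {B = Σ A (Period p)} (setoid A) proj₁

    PeriodOrbits : ℕ → Setoid 0ℓ 0ℓ
    PeriodOrbits p = On.setoid {B = Σ A (ExactPeriod p)} (≐-setoid A 0ℓ) (Orbitᶠ ∘ proj₁)

    period? : ∀ p → Decidable (Period p)
    period? p x = iterate f x p ≟ᴬ x

    exactPeriod? : ∀ p → Decidable (ExactPeriod p)
    exactPeriod? p x = period? p x ×-dec map′ (λ h d 0<d d<p → h d<p 0<d) (λ h {d} d<p 0<d → h d 0<d d<p)
      (allUpTo? (λ d → (0 <? d) →-dec ¬? (period? d x)) p)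

    exactPeriod : ∀ {x} p → 0 < p → Period p x → ∃[ d ] (0 < d × ExactPeriod d x)
    exactPeriod {x} = <-rec Q descend
      where
      Q : ℕ → Set
      Q p = 0 < p → Period p x → ∃[ d ] (0 < d × ExactPeriod d x)

      descend : ∀ p → (∀ {d} → d < p → Q d) → Q p
      descend p rec 0<p per with anyUpTo? (λ d → (0 <? d) ×-dec period? d x) p
      ... | yes (d , d<p , 0<d , d-per) = rec d<p 0<d d-per
      ... | no ∄d = p , 0<p , per , λ d 0<d d<p d-per → ∄d (d , d<p , 0<d , d-per)

    ∣⇒period : ∀ {d q x} → Period d x → d ∣ q → Period q x
    ∣⇒period d-per (divides c refl) = iterate-* f d-per c

    iterate-% : ∀ {p x} .{{_ : NonZero p}} → Period p x → ∀ t → iterate f x t ≡ iterate f x (t % p)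
    iterate-% {p} {x} per t = trans (cong (iterate f x) (m≡m%n+[m/n]*n t p)) (iterate-+-* f per (t / p) (t % p))

    -- The remainder `q % d` is again a period and is smaller than `d`, so minimality forces it to
    -- be 0.
    period⇒∣ : ∀ {d q x} .{{_ : NonZero d}} → ExactPeriod d x → Period q x → d ∣ q
    period⇒∣ {d} {q} {x} (d-per , minimal) q-per = m%n≡0⇒n∣m q d
      (n≮0⇒n≡0 λ 0<q%d → minimal (q % d) 0<q%d (m%n<n q d) (trans (sym (iterate-% d-per q)) q-per))
      where
      n≮0⇒n≡0 : ∀ {n} → ¬ (0 < n) → n ≡ 0
      n≮0⇒n≡0 {zero}  _   = refl
      n≮0⇒n≡0 {suc n} 0≮n = contradiction z<s 0≮n

    -- Following a collision at times t < u for p - t more steps brings the first branch to time p,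
    -- that is to `x`, and the second to u - t modulo p. So u - t would be too small a period.
    iterate-≢ : ∀ {p x t u} → ExactPeriod p x → t < u → u < p → iterate f x t ≢ iterate f x u
    iterate-≢ {p} {x} {t} {u} (per , minimal) t<u u<p eq =
      minimal (u ∸ t) (m<n⇒0<n∸m t<u) (≤-<-trans (m∸n≤m u t) u<p) (begin
        iterate f x (u ∸ t)                   ≡⟨ iterate-+-* f per 1 (u ∸ t) ⟨
        iterate f x (u ∸ t + 1 * p)           ≡⟨ cong (iterate f x) shift ⟩
        iterate f x (u + (p ∸ t))             ≡⟨ iterate-+ f x u (p ∸ t) ⟩
        iterate f (iterate f x u) (p ∸ t)     ≡⟨ cong (λ y → iterate f y (p ∸ t)) eq ⟨
        iterate f (iterate f x t) (p ∸ t)     ≡⟨ iterate-+ f x t (p ∸ t) ⟨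
        iterate f x (t + (p ∸ t))             ≡⟨ cong (iterate f x) (m+[n∸m]≡n t≤p) ⟩
        iterate f x p                         ≡⟨ per ⟩
        x                                     ∎)
      where
      open ≡-Reasoning
      t≤p : t ≤ p
      t≤p = <⇒≤ (<-trans t<u u<p)
      shift : u ∸ t + 1 * p ≡ u + (p ∸ t)
      shift = begin
        u ∸ t + 1 * p           ≡⟨ cong (u ∸ t +_) (*-identityˡ p) ⟩
        u ∸ t + p               ≡⟨ cong (u ∸ t +_) (m+[n∸m]≡n t≤p) ⟨
        u ∸ t + (t + (p ∸ t))   ≡⟨ +-assoc (u ∸ t) t (p ∸ t) ⟨
        u ∸ t + t + (p ∸ t)     ≡⟨ cong (_+ (p ∸ t)) (m∸n+n≡m (<⇒≤ t<u)) ⟩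
        u + (p ∸ t)             ∎

    iterate-injective : ∀ {p x t u} → ExactPeriod p x → t < p → u < p →
                        iterate f x t ≡ iterate f x u → t ≡ u
    iterate-injective {t = t} {u} exact t<p u<p eq with <-cmp t u
    ... | tri< t<u _ _ = contradiction eq (iterate-≢ exact t<u u<p)
    ... | tri≈ _ t≡u _ = t≡u
    ... | tri> _ _ u<t = contradiction (sym eq) (iterate-≢ exact u<t t<p)

    module _ {p} .{{_ : NonZero p}} where

      orbit-iterate : ∀ {x} → Period p x → ∀ t → Orbitᶠ x ≐ Orbitᶠ (iterate f x t)
      orbit-iterate {x} per t =
          -- After `t` steps, another t (p - 1) complete t full periods and return to `x`.
          (λ { (u , refl) → t * pred p + u , back u })
        , (λ { (u , refl) → t + u , iterate-+ f x t u })
        where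
        open ≡-Reasoning
        back : ∀ u → iterate f (iterate f x t) (t * pred p + u) ≡ iterate f x u
        back u = begin
          iterate f (iterate f x t) (t * pred p + u) ≡⟨ iterate-+ f x t _ ⟨
          iterate f x (t + (t * pred p + u))         ≡⟨ cong (iterate f x) (eq t (pred p) u) ⟩
          iterate f x (u + t * suc (pred p))         ≡⟨ cong (λ n → iterate f x (u + t * n)) (suc-pred p) ⟩
          iterate f x (u + t * p)                    ≡⟨ iterate-+-* f per t u ⟩
          iterate f x u                              ∎
          where
          eq : ∀ t n u → t + (t * n + u) ≡ u + t * suc n
          eq = solve-∀

      -- The bound t < p turns equality of orbits as subsets into a finite search, hence makes it
      -- decidable.
      orbit⇒iterate : ∀ {x y} → Period p x → Orbitᶠ x ≐ Orbitᶠ y → ∃[ t ] (t < p × iterate f x t ≡ y)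
      orbit⇒iterate per (_ , y⊆x) with t , eq ← y⊆x (0 , refl) =
        t % p , m%n<n t p , trans (sym (iterate-% per t)) eq

      PeriodOrbits-decSetoid : DecSetoid 0ℓ 0ℓ
      PeriodOrbits-decSetoid = record
        { isDecEquivalence = record
          { isEquivalence = Setoid.isEquivalence (PeriodOrbits p)
          ; _≟_           = λ (x , per , _) (y , _) → map′
              (λ { (t , _ , refl) → orbit-iterate per t })
              (orbit⇒iterate per)
              (anyUpTo? (λ t → iterate f x t ≟ᴬ y) p)
          }
        }

      open DecSetoid PeriodOrbits-decSetoid using () renaming (_≟_ to _≟ᴼ_)

      -- The list may carry another proof of exactness than `exact`; this is harmless because
      -- presentations are compared by orbit only.
      toList-complete : ∀ {xs} (exacts : All (ExactPeriod p) xs) {x} (exact : ExactPeriod p x) → x ∈ xs →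
                        Any (Setoid._≈_ (PeriodOrbits p) (x , exact)) (All.toList exacts)
      toList-complete (_ ∷ _)      exact (here refl) = here (id , id)
      toList-complete (_ ∷ exacts) exact (there x∈)  = there (toList-complete exacts exact x∈)

      orbits-cardinality : ∀ {xs} → (∀ {x} → Period p x → x ∈ xs) → ∃[ k ] HasCardinality (PeriodOrbits p) k
      orbits-cardinality {xs} complete = _ , enumeration-cardinality (PeriodOrbits p)
        (deduplicate-! PeriodOrbits-decSetoid presentations)
        (λ (x , exact) → Membership.∈-deduplicate⁺ (PeriodOrbits p) _≟ᴼ_
          (λ {x} {y} {z} z≈y x≈y → S.trans {x} {y} {z} x≈y (S.sym {z} {y} z≈y)) {presentations} {x , exact}
          (toList-complete (all-filter (exactPeriod? p) xs) exact
            (∈-filter⁺ (exactPeriod? p) (complete (proj₁ exact)) exact)))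
        where
        module S = Setoid (PeriodOrbits p)
        presentations = All.toList (all-filter (exactPeriod? p) xs)

      module _ {xs k} (xs! : Unique xs) (complete : ∀ {x} → Period p x → x ∈ xs)
               (orbits≅k : HasCardinality (PeriodOrbits p) k) where

        open Inverse orbits≅k using (to; from; inverseˡ; inverseʳ; strictlyInverseˡ)

        -- Orbit `i` is followed for `t` steps from its chosen representative. The lemmas below make
        -- this a bijection onto the points of exact period `p`, which therefore number k p.
        point : Fin k × Fin p → A
        point (i , t) = iterate f (proj₁ (from i)) (toℕ t)

        point-orbit : ∀ i t → Orbitᶠ (proj₁ (from i)) ≐ Orbitᶠ (point (i , t))
        point-orbit i t = orbit-iterate (proj₁ (proj₂ (from i))) (toℕ t)

        point-injectiveˡ : ∀ {i j t u} → point (i , t) ≡ point (j , u) → i ≡ j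
        point-injectiveˡ {i} {j} {t} {u} eq = trans (sym (strictlyInverseˡ i)) (inverseˡ {j} {from i} same)
          where
          open Setoid (≐-setoid A 0ℓ) using () renaming (sym to ≐-sym; trans to ≐-trans)
          same : Orbitᶠ (proj₁ (from i)) ≐ Orbitᶠ (proj₁ (from j))
          same = ≐-trans (point-orbit i t)
            (≐-sym (subst (λ y → Orbitᶠ (proj₁ (from j)) ≐ Orbitᶠ y) (sym eq) (point-orbit j u)))

        point-injective : ∀ {c d} → point c ≡ point d → c ≡ d
        point-injective {i , t} {j , u} eq with refl ← point-injectiveˡ {i} {j} {t} {u} eq = cong (i ,_)
          (toℕ-injective (iterate-injective (proj₂ (from i)) (toℕ<n t) (toℕ<n u) eq))

        point-exact : ∀ c → ExactPeriod p (point c)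
        point-exact (i , t) = per , minimal
          where
          x = proj₁ (from i)
          x-per = proj₁ (proj₂ (from i))
          commute : ∀ d → iterate f (point (i , t)) d ≡ iterate f (iterate f x d) (toℕ t)
          commute d = trans (sym (iterate-+ f x (toℕ t) d))
            (trans (cong (iterate f x) (+-comm (toℕ t) d)) (iterate-+ f x d (toℕ t)))
          per : Period p (point (i , t))
          per = trans (commute p) (cong (λ y → iterate f y (toℕ t)) x-per)
          minimal : ∀ d → 0 < d → d < p → ¬ Period d (point (i , t))
          -- The representative lies `u` steps further along the orbit and would inherit the period
          -- `d`.
          minimal d 0<d d<p d-per with u , eq ← proj₁ (point-orbit i t) (0 , refl) =
            proj₂ (proj₂ (from i)) d 0<d d<p
              (subst (Period d) eq (trans (commute′ u) (cong (λ y → iterate f y u) d-per)))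
            where
            y = point (i , t)
            commute′ : ∀ u → iterate f (iterate f y u) d ≡ iterate f (iterate f y d) u
            commute′ u = trans (sym (iterate-+ f y u d)) (trans (cong (iterate f y) (+-comm u d)) (iterate-+ f y d u))

        point-onto : ∀ {x} → ExactPeriod p x → ∃[ c ] point c ≡ x
        -- The inverse law returns the representative only up to equality of orbits; the offset `t`
        -- from it to `x` has to be recovered.
        point-onto {x} exact with t , t<p , eq ← orbit⇒iterate (proj₁ (proj₂ (from (to (x , exact))))) (inverseʳ refl) =
          (to (x , exact) , fromℕ< t<p) , trans (cong (iterate f _) (toℕ-fromℕ< t<p)) eq

        count-exact : length (filter (exactPeriod? p) xs) ≡ k * p
        count-exact = length-filter≡ (exactPeriod? p) xs! (point ∘ remQuot p)
          (λ {i} {j} eq → trans (sym (combine-remQuot {k} p i))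
            (trans (cong (uncurry combine) (point-injective eq)) (combine-remQuot {k} p j)))
          (λ i → complete (proj₁ (point-exact (remQuot p i))))
          (λ i → point-exact (remQuot p i))
          (λ exact → let (i , t) , eq = point-onto exact in
            combine i t , trans (cong point (remQuot-combine i t)) eq)

      module _ (C : (q : ℕ) .{{_ : NonZero q}} → ℕ)
               (cardinality : ∀ q .{{_ : NonZero q}} → q ∣ p → HasCardinality (PeriodPoints q) (C q)) where

        element : ∀ q .{{_ : NonZero q}} → q ∣ p → Fin (C q) → A
        element q q∣p i = proj₁ (Inverse.from (cardinality q q∣p) i)

        element-injective : ∀ q .{{_ : NonZero q}} (q∣p : q ∣ p) {i j} →
                            element q q∣p i ≡ element q q∣p j → i ≡ j
        element-injective q q∣p {i} {j} eq = trans (sym (strictlyInverseˡ i)) (inverseˡ {j} {from i} eq)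
          where open Inverse (cardinality q q∣p)

        element-onto : ∀ q .{{_ : NonZero q}} (q∣p : q ∣ p) {x} → Period q x → ∃[ i ] element q q∣p i ≡ x
        element-onto q q∣p {x} per = to (x , per) , strictlyInverseʳ (x , per)
          where open Inverse (cardinality q q∣p)

        -- The finite universe of the count, as `A` is arbitrary: a point whose period q divides p
        -- also has period p and so is listed.
        points : List A
        points = tabulate (element p ∣-refl)

        points-unique : Unique points
        points-unique = Unique.tabulate⁺ (element-injective p ∣-refl)

        points-complete : ∀ {x} → Period p x → x ∈ points
        points-complete per with i , refl ← element-onto p ∣-refl per = ∈-tabulate⁺ i

        points-sound : ∀ {x} → x ∈ points → Period p x
        points-sound x∈ with i , refl ← ∈-tabulate⁻ x∈ = proj₂ (Inverse.from (cardinality p ∣-refl) i)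

        count-period : ∀ q .{{_ : NonZero q}} → q ∣ p → length (filter (period? q) points) ≡ C q
        count-period q q∣p = length-filter≡ (period? q) points-unique (element q q∣p)
          (element-injective q q∣p)
          (λ i → points-complete (∣⇒period (element-period i) q∣p))
          element-period (element-onto q q∣p)
          where
          element-period : ∀ i → Period q (element q q∣p i)
          element-period i = proj₂ (Inverse.from (cardinality q q∣p) i)

        -- The term for q = suc i and `x` of a double sum: `expand` evaluates it over `x`,
        -- `collapse` over q.
        weight : ℕ → A → ℤ
        weight i x = if does (suc i ∣? p) ∧ does (period? (suc i) x) then μ (p / suc i) else 0ℤ

        expand : ∀ i → (if does (suc i ∣? p) then μ (p / suc i) ℤ.* ℤ.+ (C (suc i)) else 0ℤ) ≡ ∑ (weight i) points
        expand i = by-cases (suc i ∣? p)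
          where
          open ≡-Reasoning
          c = μ (p / suc i)
          per? = period? (suc i)
          by-cases : (i∣p? : Dec (suc i ∣ p)) →
            (if does i∣p? then c ℤ.* ℤ.+ (C (suc i)) else 0ℤ)
              ≡ ∑ (λ x → if does i∣p? ∧ does (per? x) then c else 0ℤ) points
          by-cases (no _)    = sym (∑-0 points)
          by-cases (yes i∣p) = begin
            c ℤ.* ℤ.+ (C (suc i))                                    ≡⟨ cong (λ n → c ℤ.* ℤ.+ n) (count-period (suc i) i∣p) ⟨
            c ℤ.* ℤ.+ length (filter per? points)                    ≡⟨ cong (c ℤ.*_) (∑-1 (filter per? points)) ⟨
            c ℤ.* ∑ (λ _ → 1ℤ) (filter per? points)                  ≡⟨ ∑-*ˡ c _ (filter per? points) ⟩
            ∑ (λ _ → c ℤ.* 1ℤ) (filter per? points)                  ≡⟨ ∑-cong (filter per? points) (λ _ → ℤ.*-identityʳ c) ⟩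
            ∑ (λ _ → c) (filter per? points)                         ≡⟨ ∑-filter per? (λ _ → c) points ⟩
            ∑ (λ x → if does (per? x) then c else 0ℤ) points         ∎

        collapse : ∀ {x} → Period p x → ∑ (λ i → weight i x) (upTo p) ≡ (if does (exactPeriod? p x) then 1ℤ else 0ℤ)
        collapse {x} per with d , 0<d , exact ← exactPeriod p (>-nonZero⁻¹ p) per = begin
          ∑ (λ i → weight i x) (upTo p)
            ≡⟨ ∑-cong (upTo p) (λ {i} _ → cong (λ b → if does (suc i ∣? p) ∧ b then μ (p / suc i) else 0ℤ)
                 (does-⇔ (mk⇔ (period⇒∣ exact) (∣⇒period (proj₁ exact))) (period? (suc i) x) (d ∣? suc i))) ⟩
          ∑ (λ i → if does (suc i ∣? p) ∧ does (d ∣? suc i) then μ (p / suc i) else 0ℤ) (upTo p)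
            ≡⟨ ∑-μ-multiples p (period⇒∣ exact per) ⟩
          (if does (d ≟ p) then 1ℤ else 0ℤ)
            -- Two exact periods of the same point divide each other.
            ≡⟨ cong (if_then 1ℤ else 0ℤ) (does-⇔ (mk⇔ (λ { refl → exact })
                 (λ p-exact → ∣-antisym (period⇒∣ exact per) (period⇒∣ p-exact (proj₁ exact)))) (d ≟ p) (exactPeriod? p x)) ⟩
          (if does (exactPeriod? p x) then 1ℤ else 0ℤ) ∎
          where
          open ≡-Reasoning
          instance
            d≢0 : NonZero d
            d≢0 = >-nonZero 0<d

        -- Multiplied out by `p`, the formula is an equation in ℤ, and divisibility of the sum by
        -- `p` comes with it.
        orbit-count : ∃[ k ] (HasCardinality (PeriodOrbits p) k
          × ℤ.+ (k * p) ≡ sumOverDivisors p (λ q → μ (p / q) ℤ.* ℤ.+ (C q)))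
        orbit-count with k , orbits≅k ← orbits-cardinality points-complete = k , orbits≅k , sym (begin
          sumOverDivisors p (λ q → μ (p / q) ℤ.* ℤ.+ (C q))
            ≡⟨ sum≡∑ (λ i → if does (suc i ∣? p) then μ (p / suc i) ℤ.* ℤ.+ (C (suc i)) else 0ℤ) id p ⟩
          ∑ (λ i → if does (suc i ∣? p) then μ (p / suc i) ℤ.* ℤ.+ (C (suc i)) else 0ℤ) (upTo p)
            ≡⟨ ∑-cong (upTo p) (λ {i} _ → expand i) ⟩
          ∑ (λ i → ∑ (weight i) points) (upTo p)
            ≡⟨ ∑-swap weight (upTo p) points ⟩
          ∑ (λ x → ∑ (λ i → weight i x) (upTo p)) points
            ≡⟨ ∑-cong points (λ x∈ → collapse (points-sound x∈)) ⟩
          ∑ (λ x → if does (exactPeriod? p x) then 1ℤ else 0ℤ) points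
            ≡⟨ ∑-filter (exactPeriod? p) (λ _ → 1ℤ) points ⟨
          ∑ (λ _ → 1ℤ) (filter (exactPeriod? p) points)
            ≡⟨ ∑-1 (filter (exactPeriod? p) points) ⟩
          ℤ.+ length (filter (exactPeriod? p) points)
            ≡⟨ cong ℤ.+_ (count-exact points-unique points-complete orbits≅k) ⟩
          ℤ.+ (k * p) ∎)
          where open ≡-Reasoning

  k*p≡n⇒k/1≡n/p : ∀ k n p .{{_ : NonZero p}} → ℤ.+ (k * p) ≡ n → ℤ.+ k /ℚ 1 ≡ n /ℚ p
  -- Cross-multiplication takes place on unnormalised fractions, which store the denominator minus
  -- one: 0 and `p-1` stand for 1 and `p`.
  k*p≡n⇒k/1≡n/p k n p@(suc p-1) kp≡n = fromℚᵘ-cong {mkℚᵘ (ℤ.+ k) 0} {mkℚᵘ n p-1}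
    (*≡* (trans (sym (ℤ.pos-* k p)) (trans kp≡n (sym (ℤ.*-identityʳ n)))))

open CircuitSignals using (ConfigsOfPeriod-cardinality)
open PeriodicOrbits using (module Dynamics; k*p≡n⇒k/1≡n/p)

open import Data.Integer.Base using (+_; _*_)
open import Data.Nat.Base using (ℕ; NonZero)
open import Data.Nat.DivMod using () renaming (_/_ to _/ℕ_)
open import Data.Nat.Divisibility using (_∣_)
open import Data.Product.Base using (_×_; ∃-syntax)
open import Data.Rational.Base using (_/_)
open import Relation.Binary.PropositionalEquality using (_≡_)
open import Relation.Nullary.Negation using (¬_)

proposition3 : (ℓ r p : ℕ) .{{_ : NonZero ℓ}} .{{_ : NonZero r}} .{{_ : NonZero p}} →
    p ∣ r → ¬ (p ∣ ℓ) →
    HasCardinality (ConfigsOfPeriod ℓ r p) (CΔ ℓ p)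
    × ∃[ k ] (HasCardinality (AttractorsOfPeriod ℓ r p) k
    × + k / 1 ≡ sumOverDivisors p (λ q → μ (p /ℕ q) * + (CΔ ℓ q)) / p)
proposition3 ℓ r p p∣r _ =
  let k , attractors≅k , kp≡sum = Dynamics.orbit-count (≡-dec Bool._≟_) (F ℓ r) (CΔ ℓ)
        -- Each q ∣ p also divides r, so the configuration count covers every term of the Möbius
        -- sum.
        (λ q q∣p → ConfigsOfPeriod-cardinality ℓ r q (∣-trans q∣p p∣r))
  in ConfigsOfPeriod-cardinality ℓ r p p∣r , k , attractors≅k , k*p≡n⇒k/1≡n/p k _ p kp≡sum
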